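{- Let $k\ge3$ and let $n_1,\dots,n_r\ge2$ be even integers. For $1\le i\le r$ let $\mathcal{F}^1_i,\dots,\mathcal{F}^k_i$ be pairwise almost orthogonal symmetric chain decompositions of $Q_{n_i}$ forming a good collection. Then there exist $k$ pairwise almost orthogonal symmetric chain decompositions $\mathcal{H}^1,\dots,\mathcal{H}^k$ of $Q_{n_1+\cdots+n_r}$ such that for each $j$ every chain of $\mathcal{H}^j$ is contained in a cuboid $A_1\times\cdots\times A_r$ with $A_i\in\mathcal{F}^j_i$ for all $i$.
   Context: $Q_n$ denotes the Boolean lattice of subsets of $[n]=\{1,\dots,n\}$ under inclusion; $Q_{n_1}\times\cdots\times Q_{n_r}$ (product order) is identified with $Q_{n_1+\cdots+n_r}$. A symmetric chain in $Q_n$ consists of exactly one subset of each size $j,\dots,n-j$ for some $j$; a symmetric chain decomposition (SCD) is a partition into symmetric chains. Two SCDs $\mathcal{F},\mathcal{G}$ of $Q_n$ are almost orthogonal if for all chains $A\in\mathcal{F}$, $B\in\mathcal{G}$, $|A\cap B|\le1$, except when $A$ and $B$ both contain $\varnothing$ and $[n]$, in which case $|A\cap B|=2$. For $n$ even, a collection $\{\mathcal{F}^j\}$ of pairwise almost orthogonal SCDs of $Q_n$ is good if the $1$-element chains occurring in the different $\mathcal{F}^j$ are pairwise distinct (no $1$-element chain belongs to two different $\mathcal{F}^j$). -}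

module Defs where

open import Data.Nat using (ℕ; zero; suc; _+_; _∸_; _≤_)
open import Data.Nat.Divisibility using (_∣_)
open import Data.Bool using (Bool)
import Data.Bool as B
open import Data.Fin using (Fin; zero; suc)
open import Data.Fin.Subset using (Subset; _⊆_; ∣_∣; ⊥; ⊤)
open import Data.Vec using (Vec; []; _∷_; lookup; take; drop; sum)
open import Data.Vec.Properties using (≡-dec)
open import Data.List using (List; length; filter; [_])
import Data.List as L
open import Data.List.Membership.Propositional using (_∈_)
import Data.List.Membership.DecPropositional as DecMem
open import Data.List.Relation.Unary.Unique.Propositional using (Unique)
open import Data.Product using (Σ; ∃; _×_; _,_)
open import Data.Sum using (_⊎_)
open import Data.Unit using () renaming (⊤ to Unit)
open import Relation.Nullary using (¬_)
open import Relation.Binary.PropositionalEquality using (_≡_; _≢_)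
open import Relation.Binary.Definitions using (DecidableEquality)

-- Q_n : subsets of [n] are Subset n = Vec Bool n (Data.Fin.Subset).
-- A chain (finite set of subsets) is represented by a duplicate-free list.
Chain : ℕ → Set
Chain n = List (Subset n)

_≟S_ : ∀ {n} → DecidableEquality (Subset n)
_≟S_ = ≡-dec B._≟_

-- |A ∩ B| for chains A, B (A duplicate-free)
interSize : ∀ {n} → Chain n → Chain n → ℕ
interSize {n} A C = length (filter (λ x → x ∈? C) A)
  where open DecMem (_≟S_ {n}) using (_∈?_)

IsChain : ∀ {n} → Chain n → Set
IsChain C = Unique C × (∀ {a b} → a ∈ C → b ∈ C → a ⊆ b ⊎ b ⊆ a)

IsSymmetricChain : (n : ℕ) → Chain n → Set
IsSymmetricChain n C =
  IsChain C ×
  Σ ℕ λ j → (j ≤ n ∸ j) ×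
    ((∀ {a} → a ∈ C → (j ≤ ∣ a ∣) × (∣ a ∣ ≤ n ∸ j)) ×
     ((s : ℕ) → j ≤ s → s ≤ n ∸ j → Σ (Subset n) λ a → (a ∈ C) × (∣ a ∣ ≡ s)) ×
     (∀ {a b} → a ∈ C → b ∈ C → ∣ a ∣ ≡ ∣ b ∣ → a ≡ b))

IsSCD : (n : ℕ) → List (Chain n) → Set
IsSCD n F =
  (∀ {C} → C ∈ F → IsSymmetricChain n C) ×
  ((S : Subset n) → Σ (Fin (length F)) λ i →
      (S ∈ L.lookup F i) × (∀ i' → S ∈ L.lookup F i' → i' ≡ i))

BothFull : ∀ {n} → Chain n → Chain n → Set
BothFull A C = (⊥ ∈ A) × (⊤ ∈ A) × (⊥ ∈ C) × (⊤ ∈ C)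

AlmostOrthogonal : (n : ℕ) → List (Chain n) → List (Chain n) → Set
AlmostOrthogonal n F G = ∀ {A C} → A ∈ F → C ∈ G →
  (BothFull A C → interSize A C ≡ 2) × (¬ BothFull A C → interSize A C ≤ 1)

PairwiseAO : (n k : ℕ) → (Fin k → List (Chain n)) → Set
PairwiseAO n k F = (∀ j → IsSCD n (F j)) ×
  (∀ j j' → j ≢ j' → AlmostOrthogonal n (F j) (F j'))

IsGood : (n k : ℕ) → (Fin k → List (Chain n)) → Set
IsGood n k F = (2 ∣ n) × PairwiseAO n k F ×
  (∀ j j' → j ≢ j' → ∀ x → [ x ] ∈ F j → ¬ ([ x ] ∈ F j'))

-- x ∈ Q_{n_1+...+n_r} lies in the cuboid A_1 × ... × A_r
-- (Q_{n_1} × ... × Q_{n_r} identified with Q_{sum} by concatenation)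
InCuboid : ∀ {r} (ns : Vec ℕ r) → ((i : Fin r) → Chain (lookup ns i)) → Subset (sum ns) → Set
InCuboid [] A x = Unit
InCuboid (n ∷ ns) A x = (take n x ∈ A zero) × InCuboid ns (λ i → A (suc i)) (drop n x)

{-# OPTIONS --safe #-}
-- Call points x ≠ y of a cuboid ∏ [0, aᵢ] a full pair if every coordinate satisfies xᵢ = yᵢ, or
-- xᵢ = 0 and yᵢ = aᵢ ≥ 4.  If chains of H^j and H^j′ share x < y, almost orthogonality in each
-- factor makes (x, y) a full pair of both surrounding cuboids: k ≥ 3 forces nᵢ ≠ 2, so a factor
-- in which x and y differ contributes a full chain with aᵢ = nᵢ ≥ 4.  Suppose each cuboid has a
-- symmetric chain decomposition in which the only full pair on a common chain is (bottom, top).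
-- Then x and y are the extreme corners of both cuboids, a coordinate with xᵢ = yᵢ would be a
-- one-element chain common to F^j and F^j′, and goodness leaves x = ∅, y = [n].
--
-- Such decompositions of cuboids with even sides are built one side at a time.  A two-dimensional
-- grid is peeled into hooks, the two outermost ones exchanging their ends so that neither contains
-- a whole row or column.  One-element chains would spoil the next product, so the last 3 × 3
-- block of a square is kept undivided; it contains no full pair since 2 < 4, and multiplying it by
-- a longer side can be done in the order (side × 2) × 2, where no one-element chain appears.
module Submission where

open import Defs
open import Data.Nat using (ℕ; zero; suc; _+_; _*_; _∸_; _≤_; z≤n; s≤s)
open import Data.Nat.Divisibility using (_∣_; divides)
open import Data.Nat.ListAction using () renaming (sum to sumᴸ)
open import Data.Nat.Properties hiding (suc-injective)
open import Data.Nat.Tactic.RingSolver using (solve-∀)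
open import Algebra.Properties.CommutativeSemigroup +-commutativeSemigroup using (x∙yz≈y∙xz)
open import Data.Empty as Empty using (⊥-elim)
open import Data.Fin using (Fin; zero; suc; toℕ; fromℕ; fromℕ<; inject₁)
open import Data.Fin.Properties
  using (toℕ-inject₁; toℕ-fromℕ; toℕ-fromℕ<; toℕ<n; toℕ-injective; inject₁-injective;
         fromℕ≢inject₁; suc-injective)
open import Data.Fin.Relation.Unary.Top using (View; view; ‵fromℕ; ‵inj₁; view-fromℕ; view-inject₁)
open import Data.Fin.Subset using (Subset; _⊆_; ∣_∣; ⊥; ⊤; inside; outside)
open import Data.Fin.Subset.Properties using (∣⊥∣≡0; ∣⊤∣≡n; p⊆q⇒∣p∣≤∣q∣; drop-∷-⊆)
open import Data.List as List using (List; []; _∷_; [_]; length; filter; tabulate)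
open import Data.List.Membership.Propositional using (_∈_)
open import Data.List.Membership.Propositional.Properties
import Data.List.Membership.DecPropositional as DecMembership
open import Data.List.Relation.Unary.All as All using (All; []; _∷_)
open import Data.List.Relation.Unary.All.Properties using (all-filter)
open import Data.List.Relation.Unary.AllPairs using ([]; _∷_)
open import Data.List.Relation.Unary.Any using (here; there; index)
open import Data.List.Relation.Unary.Any.Properties using (lookup-index)
open import Data.List.Relation.Unary.Unique.Propositional using (Unique)
import Data.List.Relation.Unary.Unique.Propositional.Properties as Unique
open import Data.Product using (Σ; ∃; _×_; _,_; proj₁; proj₂; map₂)
open import Data.Sum using (_⊎_; inj₁; inj₂)
open import Data.Unit as Unit using (tt)
open import Data.Vec as Vec using (Vec; []; _∷_; _++_; take; drop; lookup; sum)
open import Data.Vec.Properties using (take++drop≡id; ++-injective; ∷-injectiveʳ)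
open import Function using (_∘_; id)
open import Relation.Nullary using (¬_; yes; no)
open import Relation.Nullary.Decidable using (_×-dec_)
open import Relation.Binary.PropositionalEquality hiding ([_])

-- Ranked posets, full pairs in cuboids, and centred embeddings.

record Ranked : Set₁ where
  field
    Carrier : Set
    _≼_     : Carrier → Carrier → Set
    rank    : Carrier → ℕ
    height  : ℕ

open Ranked

Point : List ℕ → Set
Point []       = Unit.⊤
Point (a ∷ as) = Fin (suc a) × Point as

_≤ᶜ_ : ∀ {as} → Point as → Point as → Set
_≤ᶜ_ {[]}     _        _        = Unit.⊤
_≤ᶜ_ {a ∷ as} (x , xs) (y , ys) = toℕ x ≤ toℕ y × xs ≤ᶜ ys

rankᶜ : ∀ {as} → Point as → ℕ
rankᶜ {[]}     _        = 0
rankᶜ {a ∷ as} (x , xs) = toℕ x + rankᶜ xs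

cuboid : List ℕ → Ranked
cuboid as = record { Carrier = Point as ; _≼_ = _≤ᶜ_ ; rank = rankᶜ ; height = sumᴸ as }

bot top : ∀ as → Point as
bot []       = tt
bot (a ∷ as) = zero , bot as
top []       = tt
top (a ∷ as) = fromℕ a , top as

-- Sides 2 must be exempt: in every symmetric chain decomposition of the 3 × 3 × 3 cuboid, some chain
-- has x < y, not (bottom, top), with each (xᵢ , yᵢ) equal to (0 , 2) or on the diagonal.
Full₁ : ∀ a → Fin (suc a) → Fin (suc a) → Set
Full₁ a x y = x ≡ y ⊎ (4 ≤ a × x ≡ zero × y ≡ fromℕ a)

Full : ∀ as → Point as → Point as → Set
Full []       _        _        = Unit.⊤
Full (a ∷ as) (x , xs) (y , ys) = Full₁ a x y × Full as xs ys

Full-refl : ∀ as {x} → Full as x x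
Full-refl []       = tt
Full-refl (a ∷ as) = inj₁ refl , Full-refl as

-- By `centred` the two corners of the piece lie at complementary ranks of `T`, so a piece with a
-- single side is a symmetric chain.
record Embedding (as : List ℕ) (T : Ranked) : Set where
  field
    fun      : Point as → Carrier T
    base     : ℕ
    mono     : ∀ {x y} → x ≤ᶜ y → _≼_ T (fun x) (fun y)
    rank-fun : ∀ x → rank T (fun x) ≡ base + rankᶜ x
    centred  : base + base + sumᴸ as ≡ height T

open Embedding

-- Closed under composition and products, and strong enough to keep (bottom, top) the only full
-- pair; `corner` rules out one-point pieces, whose product with a side would violate it.
record Taut {as bs} (e : Embedding as (cuboid bs)) : Set where
  field
    reflect : ∀ {x y} → Full bs (fun e x) (fun e y) → Full as x y
    corner  : Full bs (fun e (bot as)) (fun e (top as)) →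
              fun e (bot as) ≡ bot bs × fun e (top as) ≡ top bs

open Taut

id-emb : ∀ as → Embedding as (cuboid as)
id-emb as = record
  { fun = id ; base = 0 ; mono = id ; rank-fun = λ _ → refl ; centred = refl }

id-taut : ∀ as → Taut (id-emb as)
id-taut as = record { reflect = id ; corner = λ _ → refl , refl }

_∘ᵉ_ : ∀ {as bs T} → Embedding bs T → Embedding as (cuboid bs) → Embedding as T
_∘ᵉ_ {as} {bs} {T} g f = record
  { fun      = fun g ∘ fun f
  ; base     = base g + base f
  ; mono     = mono g ∘ mono f
  ; rank-fun = λ x → trans (rank-fun g (fun f x))
                 (trans (cong (base g +_) (rank-fun f x)) (sym (+-assoc (base g) _ _)))
  ; centred  = begin
      base g + base f + (base g + base f) + sumᴸ as   ≡⟨ lemma (base g) (base f) (sumᴸ as) ⟩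
      base g + base g + (base f + base f + sumᴸ as)   ≡⟨ cong (base g + base g +_) (centred f) ⟩
      base g + base g + sumᴸ bs                       ≡⟨ centred g ⟩
      height T                                       ∎ }
  where
  open ≡-Reasoning
  lemma : ∀ a b c → a + b + (a + b) + c ≡ a + a + (b + b + c)
  lemma = solve-∀

∘-taut : ∀ {as bs cs} {g : Embedding bs (cuboid cs)} {f : Embedding as (cuboid bs)} →
         Taut g → Taut f → Taut (g ∘ᵉ f)
∘-taut {g = g} {f} tg tf = record
  { reflect = reflect tf ∘ reflect tg
  -- Pulled back through `g`, the pair becomes full in `bs`; the corner rule of `f` then moves it to
  -- the corners of `bs`, where that of `g` applies.
  ; corner  = λ h → let (p , q) = corner tf (reflect tg h)
                        (r , s) = corner tg (subst₂ (λ x y → Full _ (fun g x) (fun g y)) p q h)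
                    in trans (cong (fun g) p) r , trans (cong (fun g) q) s }

cons-emb : ∀ a {as bs} → Embedding as (cuboid bs) → Embedding (a ∷ as) (cuboid (a ∷ bs))
cons-emb a {as} {bs} e = record
  { fun      = map₂ (fun e)
  ; base     = base e
  ; mono     = λ (h , hs) → h , mono e hs
  ; rank-fun = λ (x , xs) → trans (cong (toℕ x +_) (rank-fun e xs)) (x∙yz≈y∙xz (toℕ x) (base e) _)
  ; centred  = trans (sym (x∙yz≈y∙xz a (base e + base e) (sumᴸ as))) (cong (a +_) (centred e)) }

cons-taut : ∀ a {as bs} {e : Embedding as (cuboid bs)} → Taut e → Taut (cons-emb a e)
cons-taut a t = record
  { reflect = map₂ (reflect t)
  ; corner  = λ (_ , h) → let (p , q) = corner t h in cong (zero ,_) p , cong (fromℕ a ,_) q }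

-- Partitions into embedded cuboids, and taut tilings.

record Partition {S : Set} (code : S → List ℕ) (T : Ranked) : Set₁ where
  field
    I       : Set
    shape   : I → S
    emb     : ∀ i → Embedding (code (shape i)) T
    -- One two-sided inverse for all pieces together: it expresses covering, disjointness and
    -- injectivity at once.
    loc     : Carrier T → Σ I (Point ∘ code ∘ shape)
    fun-loc : ∀ x → fun (emb (proj₁ (loc x))) (proj₂ (loc x)) ≡ x
    loc-fun : ∀ i x → loc (fun (emb i) x) ≡ (i , x)

  fun-injective : ∀ i {x y} → fun (emb i) x ≡ fun (emb i) y → x ≡ y
  fun-injective i {x} {y} h with trans (sym (loc-fun i x)) (trans (cong loc h) (loc-fun i y))
  ... | refl = refl

open Partition

module _ {S S′ : Set} {code : S → List ℕ} {code′ : S′ → List ℕ} {T : Ranked} where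

  bind : (P : Partition code T) → (∀ i → Partition code′ (cuboid (code (shape P i)))) →
         Partition code′ T
  bind P R = record
    { I       = Σ (I P) λ i → I (R i)
    ; shape   = λ (i , k) → shape (R i) k
    ; emb     = λ (i , k) → emb P i ∘ᵉ emb (R i) k
    ; loc     = refine ∘ loc P
    ; fun-loc = λ x → trans (cong (fun (emb P _)) (fun-loc (R _) _)) (fun-loc P x)
    ; loc-fun = λ (i , k) x → trans (cong refine (loc-fun P i _))
                                    (cong (λ (k , x) → (i , k) , x) (loc-fun (R i) k x)) }
    where
    refine : Σ (I P) (λ i → Point (code (shape P i))) →
             Σ (Σ (I P) λ i → I (R i)) λ (i , k) → Point (code′ (shape (R i) k))
    refine (i , x) = let (k , y) = loc (R i) x in (i , k) , y

record Tiling {S : Set} (code : S → List ℕ) (as : List ℕ) : Set₁ where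
  field
    part : Partition code (cuboid as)
    taut : ∀ i → Taut (emb part i)

open Tiling

bindᵗ : ∀ {S S′} {code : S → List ℕ} {code′ : S′ → List ℕ} {as} →
        (P : Tiling code as) → (∀ i → Tiling code′ (code (shape (part P) i))) → Tiling code′ as
bindᵗ P R = record
  { part = bind (part P) (part ∘ R)
  ; taut = λ (i , k) → ∘-taut (taut P i) (taut (R i) k) }

cons-partition : ∀ a {S} {code : S → List ℕ} {as} → Partition code (cuboid as) →
                 Partition (λ s → a ∷ code s) (cuboid (a ∷ as))
cons-partition a P = record
  { I       = I P
  ; shape   = shape P
  ; emb     = λ i → cons-emb a (emb P i)
  ; loc     = λ (x , xs) → let (i , y) = loc P xs in i , x , y
  ; fun-loc = λ (x , xs) → cong (x ,_) (fun-loc P xs)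
  ; loc-fun = λ i (x , xs) → cong (λ (i , y) → i , x , y) (loc-fun P i xs) }

consᵗ : ∀ a {S} {code : S → List ℕ} {as} → Tiling code as → Tiling (λ s → a ∷ code s) (a ∷ as)
consᵗ a P = record { part = cons-partition a (part P) ; taut = λ i → cons-taut a (taut P i) }

record Iso (as bs : List ℕ) : Set where
  field
    to      : Embedding as (cuboid bs)
    to-taut : Taut to
    from    : Point bs → Point as
    to-from : ∀ x → fun to (from x) ≡ x
    from-to : ∀ x → from (fun to x) ≡ x

whole : ∀ {S} {code : S → List ℕ} (s : S) {as} → Iso (code s) as → Tiling code as
whole s i = record
  { part = record
    { I = Unit.⊤ ; shape = λ _ → s ; emb = λ _ → to ; loc = λ x → tt , from x
    ; fun-loc = to-from ; loc-fun = λ _ x → cong (tt ,_) (from-to x) }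
  ; taut = λ _ → to-taut }
  where open Iso i

id-iso : ∀ as → Iso as as
id-iso as = record
  { to = id-emb as ; to-taut = id-taut as ; from = id ; to-from = λ _ → refl ; from-to = λ _ → refl }

zero-iso : ∀ as → Iso as (0 ∷ as)
zero-iso as = record
  { to = record { fun = zero ,_ ; base = 0 ; mono = z≤n ,_ ; rank-fun = λ _ → refl ; centred = refl }
  ; to-taut = record { reflect = proj₂ ; corner = λ _ → refl , refl }
  ; from = proj₂
  ; to-from = λ { (zero , _) → refl }
  ; from-to = λ _ → refl }

zero-iso′ : ∀ a → Iso (a ∷ []) (a ∷ 0 ∷ [])
zero-iso′ a = record
  { to = record { fun = λ (x , _) → x , zero , tt ; base = 0 ; mono = λ (h , _) → h , z≤n , tt
                ; rank-fun = λ _ → refl ; centred = refl }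
  ; to-taut = record { reflect = map₂ _ ; corner = λ _ → refl , refl }
  ; from = λ (x , _) → x , tt
  ; to-from = λ { (_ , zero , _) → refl }
  ; from-to = λ _ → refl }

swap-iso : ∀ a b cs → Iso (a ∷ b ∷ cs) (b ∷ a ∷ cs)
swap-iso a b cs = record
  { to = record { fun = λ (x , y , z) → y , x , z ; base = 0 ; mono = λ (h , k , l) → k , h , l
                ; rank-fun = λ (x , y , z) → x∙yz≈y∙xz (toℕ y) (toℕ x) (rankᶜ z)
                ; centred = x∙yz≈y∙xz a b (sumᴸ cs) }
  ; to-taut = record { reflect = λ (h , k , l) → k , h , l ; corner = λ _ → refl , refl }
  ; from = λ (x , y , z) → y , x , z
  ; to-from = λ _ → refl
  ; from-to = λ _ → refl }

-- Hooks in a grid.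

-- Up the first column, then along the last row.
hook : ∀ c {m} → Fin (2 + (c + m)) → Fin (2 + m) × Fin (1 + c)
hook zero    p       = p , zero
hook (suc c) zero    = zero , zero
hook (suc c) (suc p) = map₂ suc (hook c p)

-- Junk off the hook.
hook⁻¹ : ∀ c {m} → Fin (2 + m) × Fin (1 + c) → Fin (2 + (c + m))
hook⁻¹ zero    (x , y)     = x
hook⁻¹ (suc c) (x , zero)  = zero
hook⁻¹ (suc c) (x , suc y) = suc (hook⁻¹ c (x , y))

hook⁻¹-hook : ∀ c {m} (p : Fin (2 + (c + m))) → hook⁻¹ c (hook c p) ≡ p
hook⁻¹-hook zero    p       = refl
hook⁻¹-hook (suc c) zero    = refl
hook⁻¹-hook (suc c) (suc p) = cong suc (hook⁻¹-hook c p)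

hook-injective : ∀ c {m} {p q : Fin (2 + (c + m))} → hook c p ≡ hook c q → p ≡ q
hook-injective c {p = p} {q} h =
  trans (sym (hook⁻¹-hook c p)) (trans (cong (hook⁻¹ c) h) (hook⁻¹-hook c q))

hook-column : ∀ c {m} y → hook c {m} (hook⁻¹ c (zero , y)) ≡ (zero , y)
hook-column zero    zero    = refl
hook-column (suc c) zero    = refl
hook-column (suc c) (suc y) = cong (map₂ suc) (hook-column c y)

hook-row : ∀ c {m} x → hook c {m} (hook⁻¹ c (x , fromℕ c)) ≡ (x , fromℕ c)
hook-row zero    x = refl
hook-row (suc c) x = cong (map₂ suc) (hook-row c x)

-- The turning point `(zero , fromℕ c)` counts as `column` only, so the two cases are disjoint.
data OnHook {m c} : Fin (2 + m) × Fin (1 + c) → Set where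
  column : ∀ y → OnHook (zero , y)
  row    : ∀ x → OnHook (suc x , fromℕ c)

hook-on : ∀ c {m} (p : Fin (2 + (c + m))) → OnHook (hook c p)
hook-on zero    zero    = column zero
hook-on zero    (suc p) = row p
hook-on (suc c) zero    = column zero
hook-on (suc c) (suc p) with hook c p | hook-on c p
... | _ | column y = column (suc y)
... | _ | row x    = row x

hook-mono : ∀ c {m} {p q : Fin (2 + (c + m))} → toℕ p ≤ toℕ q →
            toℕ (proj₁ (hook c p)) ≤ toℕ (proj₁ (hook c q)) ×
            toℕ (proj₂ (hook c p)) ≤ toℕ (proj₂ (hook c q))
hook-mono zero    h                             = h , z≤n
hook-mono (suc c) {p = zero}              h       = z≤n , z≤n
hook-mono (suc c) {p = suc p} {q = suc q} (s≤s h) = map₂ s≤s (hook-mono c h)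

hook-rank : ∀ c {m} (p : Fin (2 + (c + m))) →
            toℕ (proj₁ (hook c p)) + toℕ (proj₂ (hook c p)) ≡ toℕ p
hook-rank zero    p       = +-identityʳ _
hook-rank (suc c) zero    = refl
hook-rank (suc c) (suc p) = trans (+-suc _ _) (cong suc (hook-rank c p))

hook-top : ∀ c {m} → hook c {m} (fromℕ (1 + (c + m))) ≡ (fromℕ (suc m) , fromℕ c)
hook-top zero    = refl
hook-top (suc c) = cong (map₂ suc) (hook-top c)

-- Peeling two hooks off a grid.

data Layer : Set where
  lower upper inner : Layer

-- The hook of [0, m + 1] × [0, c + 1] is placed twice in [0, m + 2] × [0, c + 2], shifted right and
-- shifted up; the first copy is completed by the two corners (0 , 0) and (m + 2 , c + 2).
module Peel (m c : ℕ) where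

  Grid : Set
  Grid = Point (2 + m ∷ 2 + c ∷ [])

  layer : Layer → List ℕ
  layer lower = 4 + (c + m) ∷ []
  layer upper = 2 + (c + m) ∷ []
  layer inner = m ∷ c ∷ []

  right up : Fin (2 + m) × Fin (2 + c) → Grid
  right (x , y) = suc x , inject₁ y , tt
  up    (x , y) = inject₁ x , suc y , tt

  lower-view : ∀ {p : Fin (4 + (c + m))} → View p → Grid
  lower-view ‵fromℕ         = fromℕ _ , fromℕ _ , tt
  lower-view (‵inj₁ {i = p} _) = right (hook (suc c) p)

  place : ∀ l → Point (layer l) → Grid
  place lower (zero , _)  = zero , zero , tt
  place lower (suc p , _) = lower-view (view p)
  place upper (p , _)     = up (hook (suc c) p)
  -- The hooks use up the first two columns and the last two rows, together with the corner
  -- `(m + 2 , c + 2)`; what remains is the block with first coordinate at least 2 and second at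
  -- most `c`.
  place inner (x , y , _) = suc (suc x) , inject₁ (inject₁ y) , tt

  place-lower : ∀ p → place lower (suc (inject₁ p) , tt) ≡ right (hook (suc c) p)
  place-lower p rewrite view-inject₁ p = refl

  place-top : place lower (fromℕ _ , tt) ≡ (fromℕ _ , fromℕ _ , tt)
  place-top rewrite view-fromℕ (3 + (c + m)) = refl

  Located : Set
  Located = Σ Layer (Point ∘ layer)

  locate-last : ∀ {x : Fin (3 + m)} → View x → Located
  locate-last ‵fromℕ            = lower , fromℕ _ , tt
  locate-last (‵inj₁ {i = x} _) = upper , hook⁻¹ (suc c) (x , fromℕ _) , tt

  locate-init : ∀ (x : Fin (2 + m)) {y : Fin (2 + c)} → View y → Located
  locate-init zero    {y} _             = lower , suc (inject₁ (hook⁻¹ (suc c) (zero , y))) , tt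
  locate-init (suc x) ‵fromℕ            = lower , suc (inject₁ (hook⁻¹ (suc c) (suc x , fromℕ _))) , tt
  locate-init (suc x) (‵inj₁ {i = y} _) = inner , x , y , tt

  locate-suc : ∀ (x : Fin (2 + m)) {y : Fin (3 + c)} → View y → Located
  locate-suc x ‵fromℕ            = locate-last (view (suc x))
  locate-suc x (‵inj₁ {i = y} _) = locate-init x (view y)

  locate : Grid → Located
  locate (zero  , zero  , _) = lower , zero , tt
  locate (zero  , suc y , _) = upper , hook⁻¹ (suc c) (zero , y) , tt
  locate (suc x , y     , _) = locate-suc x (view y)

  place′ : Located → Grid
  place′ (l , p) = place l p

  place-locate-last : ∀ {x : Fin (3 + m)} (v : View x) → place′ (locate-last v) ≡ (x , fromℕ _ , tt)
  place-locate-last ‵fromℕ            = place-top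
  place-locate-last (‵inj₁ {i = x} _) = cong up (hook-row (suc c) x)

  place-locate-init : ∀ x {y} (v : View y) → place′ (locate-init x v) ≡ right (x , y)
  place-locate-init zero    {y} _             = trans (place-lower _) (cong right (hook-column (suc c) y))
  place-locate-init (suc x) ‵fromℕ            = trans (place-lower _) (cong right (hook-row (suc c) (suc x)))
  place-locate-init (suc x) (‵inj₁ {i = y} _) = refl

  place-locate-suc : ∀ x {y} (v : View y) → place′ (locate-suc x v) ≡ (suc x , y , tt)
  place-locate-suc x ‵fromℕ            = place-locate-last (view (suc x))
  place-locate-suc x (‵inj₁ {i = y} _) = place-locate-init x (view y)

  place-locate : ∀ g → place′ (locate g) ≡ g
  place-locate (zero  , zero  , _) = refl
  place-locate (zero  , suc y , _) = cong up (hook-column (suc c) y)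
  place-locate (suc x , y     , _) = place-locate-suc x (view y)

  -- `OnHook` is essential: for `g` off the hook, `right g` is a point of the inner block.
  locate-right : ∀ {g} → OnHook g → locate (right g) ≡ (lower , suc (inject₁ (hook⁻¹ (suc c) g)) , tt)
  locate-right (column y) rewrite view-inject₁ y = refl
  locate-right (row x)    rewrite view-inject₁ (fromℕ (suc c)) | view-fromℕ (suc c) = refl

  locate-up : ∀ {g} → OnHook g → locate (up g) ≡ (upper , hook⁻¹ (suc c) g , tt)
  locate-up (column y) = refl
  locate-up (row x) rewrite view-fromℕ (2 + c) | view-inject₁ (suc x) = refl

  locate-lower-view : ∀ {p} (v : View p) → locate (lower-view v) ≡ (lower , suc p , tt)
  locate-lower-view ‵fromℕ rewrite view-fromℕ (2 + c) | view-fromℕ (2 + m) = refl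
  locate-lower-view (‵inj₁ {i = p} _) =
    trans (locate-right (hook-on (suc c) p))
          (cong (λ q → lower , suc (inject₁ q) , tt) (hook⁻¹-hook (suc c) p))

  locate-place : ∀ l p → locate (place l p) ≡ (l , p)
  locate-place lower (zero  , _) = refl
  locate-place lower (suc p , _) = locate-lower-view (view p)
  locate-place upper (p     , _) =
    trans (locate-up (hook-on (suc c) p)) (cong (λ q → upper , q , tt) (hook⁻¹-hook (suc c) p))
  locate-place inner (x , y , _)
    rewrite view-inject₁ (inject₁ y) | view-inject₁ y = refl

  private
    ≤-fromℕ : ∀ {n} (x : Fin (suc n)) → toℕ x ≤ toℕ (fromℕ n)
    ≤-fromℕ {n} x rewrite toℕ-fromℕ n = ≤-pred (toℕ<n x)

    inject₁-mono-≤ : ∀ {n} {x y : Fin n} → toℕ x ≤ toℕ y → toℕ (inject₁ x) ≤ toℕ (inject₁ y)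
    inject₁-mono-≤ {x = x} {y} h rewrite toℕ-inject₁ x | toℕ-inject₁ y = h

  lower-mono : ∀ {p q : Fin (4 + (c + m))} (v : View p) (w : View q) → toℕ p ≤ toℕ q →
               lower-view v ≤ᶜ lower-view w
  lower-mono v ‵fromℕ h = let (x , y , _) = lower-view v in ≤-fromℕ x , ≤-fromℕ y , tt
  lower-mono ‵fromℕ (‵inj₁ {i = q} _) h rewrite toℕ-inject₁ q | toℕ-fromℕ (3 + (c + m)) =
    ⊥-elim (<⇒≱ (toℕ<n q) h)
  lower-mono (‵inj₁ {i = p} _) (‵inj₁ {i = q} _) h
    rewrite toℕ-inject₁ p | toℕ-inject₁ q =
    let (a , b) = hook-mono (suc c) h in s≤s a , inject₁-mono-≤ b , tt

  place-mono : ∀ l {p q} → p ≤ᶜ q → place l p ≤ᶜ place l q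
  place-mono lower {zero  , _}              _           = z≤n , z≤n , tt
  place-mono lower {suc p , _} {suc q , _} (s≤s h , _) = lower-mono (view p) (view q) h
  place-mono upper {p , _} {q , _} (h , _)     = let (a , b) = hook-mono (suc c) h in inject₁-mono-≤ a , s≤s b , tt
  place-mono inner (a , b , _) = s≤s (s≤s a) , inject₁-mono-≤ (inject₁-mono-≤ b) , tt

  offset : Layer → ℕ
  offset lower = 0
  offset upper = 1
  offset inner = 2

  lower-rank : ∀ {p : Fin (4 + (c + m))} (v : View p) → rankᶜ (lower-view v) ≡ suc (toℕ p)
  lower-rank ‵fromℕ rewrite toℕ-fromℕ m | toℕ-fromℕ c | toℕ-fromℕ (c + m) | +-identityʳ c = lemma m c
    where
    lemma : ∀ m c → 2 + m + (2 + c) ≡ 4 + (c + m)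
    lemma = solve-∀
  lower-rank (‵inj₁ {i = p} _)
    rewrite +-identityʳ (toℕ (inject₁ (proj₂ (hook (suc c) p))))
          | toℕ-inject₁ (proj₂ (hook (suc c) p)) | toℕ-inject₁ p =
    cong suc (hook-rank (suc c) p)

  place-rank : ∀ l p → rankᶜ (place l p) ≡ offset l + rankᶜ p
  place-rank lower (zero  , _) = refl
  place-rank lower (suc p , _) = trans (lower-rank (view p)) (sym (+-identityʳ _))
  place-rank upper (p , _) rewrite +-identityʳ (toℕ p) | toℕ-inject₁ (proj₁ (hook (suc c) p))
    | +-identityʳ (toℕ (proj₂ (hook (suc c) p))) =
    trans (+-suc _ _) (cong suc (hook-rank (suc c) p))
  place-rank inner (x , y , _) rewrite toℕ-inject₁ (inject₁ y) | toℕ-inject₁ y = refl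

  place-centred : ∀ l → offset l + offset l + sumᴸ (layer l) ≡ 2 + m + (2 + c + 0)
  place-centred lower = lemma m c
    where
    lemma : ∀ m c → 4 + (c + m) + 0 ≡ 2 + m + (2 + c + 0)
    lemma = solve-∀
  place-centred upper = lemma m c
    where
    lemma : ∀ m c → 2 + (2 + (c + m) + 0) ≡ 2 + m + (2 + c + 0)
    lemma = solve-∀
  place-centred inner = lemma m c
    where
    lemma : ∀ m c → 4 + (m + (c + 0)) ≡ 2 + m + (2 + c + 0)
    lemma = solve-∀

  partition : Partition layer (cuboid (2 + m ∷ 2 + c ∷ []))
  partition = record
    { I = Layer ; shape = id
    ; emb = λ l → record { fun = place l ; base = offset l ; mono = place-mono l
                         ; rank-fun = place-rank l ; centred = place-centred l }
    ; loc = locate ; fun-loc = place-locate ; loc-fun = locate-place }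

  -- This and `full-inject` are the purpose of the shifts. Each shifted copy avoids the value 0 in
  -- one coordinate and the maximum in the other, so two of its points can form a full pair only by
  -- being equal.
  full-suc : ∀ {a x y} → Full₁ (suc a) (suc x) y → suc x ≡ y
  full-suc (inj₁ h) = h

  full-inject : ∀ {a x y} → Full₁ (suc a) x (inject₁ y) → x ≡ inject₁ y
  full-inject (inj₁ h)           = h
  full-inject (inj₂ (_ , _ , h)) = ⊥-elim (fromℕ≢inject₁ (sym h))

  -- The corner `(m + 2 , 0)` is the only candidate on the shifted hook for a full pair with either
  -- of the added corners. The hook turns at the opposite corner and so misses it.
  no-corner : ∀ {g : Fin (2 + m) × Fin (2 + c)} → OnHook g →
              suc (proj₁ g) ≡ fromℕ (2 + m) → inject₁ (proj₂ g) ≡ zero → Empty.⊥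
  no-corner (column y) () _
  no-corner (row x)    _ ()

  lower-reflect : ∀ {p q : Fin (4 + (c + m))} (v : View p) (w : View q) →
                  Full _ (lower-view v) (lower-view w) → p ≡ q
  lower-reflect ‵fromℕ ‵fromℕ _ = refl
  lower-reflect ‵fromℕ (‵inj₁ _) (_ , h , _) = ⊥-elim (fromℕ≢inject₁ (full-inject h))
  lower-reflect (‵inj₁ _) ‵fromℕ (_ , inj₁ h , _) = ⊥-elim (fromℕ≢inject₁ (sym h))
  lower-reflect (‵inj₁ {i = p} _) ‵fromℕ (h , inj₂ (_ , k , _) , _) =
    ⊥-elim (no-corner (hook-on (suc c) p) (full-suc h) k)
  lower-reflect (‵inj₁ {i = p} _) (‵inj₁ {i = q} _) (h , k , _) =
    cong inject₁ (hook-injective (suc c)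
      (cong₂ _,_ (suc-injective (full-suc h)) (inject₁-injective (full-inject k))))

  lower-zero : ∀ {q : Fin (4 + (c + m))} (w : View q) →
               Full _ (zero , zero , tt) (lower-view w) → suc q ≡ fromℕ _
  lower-zero ‵fromℕ _ = refl
  lower-zero (‵inj₁ {i = q} _) (inj₂ (_ , _ , h) , k , _) =
    ⊥-elim (no-corner (hook-on (suc c) q) h (sym (full-inject k)))

  lower-suc : ∀ {p : Fin (4 + (c + m))} (v : View p) → ¬ Full _ (lower-view v) (zero , zero , tt)
  lower-suc ‵fromℕ    (inj₁ () , _)
  lower-suc ‵fromℕ    (inj₂ (_ , () , _) , _)
  lower-suc (‵inj₁ _) (inj₁ () , _)
  lower-suc (‵inj₁ _) (inj₂ (_ , () , _) , _)

  -- The lower chain joins the corners of the grid, as `corner` demands; the ends of the other two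
  -- pieces form no full pair. For the inner piece this takes two distinct ends, since a single
  -- point is full with itself without being a corner of the grid.
  place-taut : bot (m ∷ c ∷ []) ≢ top (m ∷ c ∷ []) → ∀ l → Taut (emb partition l)
  place-taut _ lower = record
    { reflect = λ {x} {y} → reflect′ {x} {y} ; corner = λ _ → refl , place-top }
    where
    reflect′ : ∀ {p q} → Full _ (place lower p) (place lower q) → Full (layer lower) p q
    reflect′ {zero  , _} {zero  , _} _ = inj₁ refl , tt
    reflect′ {zero  , _} {suc q , _} h =
      -- The two added corners give the lower chain a length of at least 4, so its ends form a full
      -- pair in its own right.
      inj₂ (s≤s (s≤s (s≤s (s≤s z≤n))) , refl , lower-zero (view q) h) , tt
    reflect′ {suc p , _} {zero  , _} h = ⊥-elim (lower-suc (view p) h)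
    reflect′ {suc p , _} {suc q , _} h = inj₁ (cong suc (lower-reflect (view p) (view q) h)) , tt
  place-taut _ upper = record
    { reflect = λ (h , k , _) → inj₁ (hook-injective (suc c)
        (cong₂ _,_ (inject₁-injective (full-inject h)) (suc-injective (full-suc k)))) , tt
    ; corner  = λ (_ , h , _) → ⊥-elim (absurd (trans (full-suc h) (cong suc (cong proj₂ (hook-top (suc c)))))) }
    where
    absurd : suc zero ≡ suc (fromℕ (suc c)) → Empty.⊥
    absurd ()
  place-taut bot≢top inner = record
    { reflect = reflect-eq
    ; corner  = λ h → ⊥-elim (bot≢top (point-eq h)) }
    where
    point-eq : ∀ {p q : Point (m ∷ c ∷ [])} → Full _ (place inner p) (place inner q) → p ≡ q
    point-eq (h , k , _) = cong₂ (λ x y → x , y , tt)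
      (suc-injective (suc-injective (full-suc h)))
      (inject₁-injective (inject₁-injective (full-inject k)))
    reflect-eq : ∀ {p q : Point (m ∷ c ∷ [])} → Full _ (place inner p) (place inner q) → Full _ p q
    reflect-eq h with point-eq h
    ... | refl = Full-refl (m ∷ c ∷ [])

  tiling : bot (m ∷ c ∷ []) ≢ top (m ∷ c ∷ []) → Tiling layer (2 + m ∷ 2 + c ∷ [])
  tiling bot≢top = record { part = partition ; taut = place-taut bot≢top }

-- Taut tilings of cuboids with even sides.

data Even : ℕ → Set where
  even-zero : Even 0
  even-ss   : ∀ {n} → Even n → Even (2 + n)

even-+ : ∀ {m n} → Even m → Even n → Even (m + n)
even-+ even-zero    f = f
even-+ (even-ss e) f = even-ss (even-+ e f)

-- A `chain` has length at least 2. One-element pieces occur only as `point`, which arises when all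
-- sides are 0.
data Shape : Set where
  point : Shape
  chain : ∀ {n} → Even n → Shape
  block : Shape

lengths : Shape → List ℕ
lengths point         = []
lengths (chain {n} _) = 2 + n ∷ []
lengths block         = 2 ∷ 2 ∷ []

grid : ∀ {m c} → Even m → Even c → Tiling lengths (2 + m ∷ 2 + c ∷ [])
grid-layer : ∀ {m c} (e : Even m) (f : Even c) → bot (m ∷ c ∷ []) ≢ top (m ∷ c ∷ []) →
             ∀ l → Tiling lengths (Peel.layer m c l)

-- Peeling this square would leave an inner piece whose `bot` and `top` coincide.
grid even-zero    even-zero    = whole block (id-iso _)
grid {m} {c} even-zero f@(even-ss _) = bindᵗ (Peel.tiling m c λ ()) (grid-layer even-zero f λ ())
grid {m} {c} e@(even-ss _) f         = bindᵗ (Peel.tiling m c λ ()) (grid-layer e f λ ())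

grid-layer e f _ lower = whole (chain (even-ss (even-+ f e))) (id-iso _)
grid-layer e f _ upper = whole (chain (even-+ f e)) (id-iso _)
grid-layer even-zero   even-zero   h inner = ⊥-elim (h refl)
grid-layer even-zero   (even-ss f) _ inner = whole (chain f) (zero-iso _)
grid-layer (even-ss e) even-zero   _ inner = whole (chain e) (zero-iso′ _)
grid-layer (even-ss e) (even-ss f) _ inner = grid e f

Discrete : List ℕ → Set
Discrete as = ∀ {x y : Point as} → Full as x y → x ≡ y

-- Where full pairs are trivial, injectivity of the pieces gives `reflect`, and `corner` holds
-- vacuously for a piece with more than one point.
discrete-taut : ∀ {S} {code : S → List ℕ} {bs} (P : Partition code (cuboid bs)) → Discrete bs →
                ∀ i → bot (code (shape P i)) ≢ top (code (shape P i)) → Taut (emb P i)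
discrete-taut P d i bot≢top = record
  { reflect = λ h → subst (Full _ _) (fun-injective P i (d h)) (Full-refl _)
  ; corner  = λ h → ⊥-elim (bot≢top (fun-injective P i (d h))) }

two-discrete : ∀ {as} → Discrete as → Discrete (2 ∷ as)
two-discrete d (inj₁ refl                    , k) = cong (_ ,_) (d k)
two-discrete d (inj₂ (s≤s (s≤s ()) , _ , _) , k)

-- A mere `Partition`: its inner piece is one point, which is not taut. It becomes admissible once
-- multiplied by a further side.
split-block : Partition (Peel.layer 0 0) (cuboid (2 ∷ 2 ∷ []))
split-block = Peel.partition 0 0

-- Peeling two of the sides leaves slabs with sides 2 and 4, sides 2 and 2, and a chain of length 2
-- over the leftover point. All sides of the cube being 2, it has only trivial full pairs, so these
-- slabs are taut.
cube : Tiling lengths (2 ∷ 2 ∷ 2 ∷ [])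
cube = bindᵗ (record { part = slabs ; taut = slabs-taut }) tile
  where
  slabs : Partition (λ l → 2 ∷ Peel.layer 0 0 l) (cuboid (2 ∷ 2 ∷ 2 ∷ []))
  slabs = cons-partition 2 split-block
  slabs-taut : ∀ l → Taut (emb slabs l)
  slabs-taut l = discrete-taut slabs (two-discrete (two-discrete (two-discrete λ _ → refl))) l λ ()
  tile : ∀ l → Tiling lengths (2 ∷ Peel.layer 0 0 l)
  tile lower = grid even-zero (even-ss even-zero)
  tile upper = grid even-zero even-zero
  tile inner = bindᵗ (consᵗ 2 {code = λ (_ : Unit.⊤) → 0 ∷ []} (whole tt (zero-iso _)))
                     λ _ → whole (chain even-zero) (zero-iso′ _)

times-two : ∀ s → Tiling lengths (2 ∷ lengths s)
times-two point     = whole (chain even-zero) (id-iso _)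
times-two (chain e) = grid even-zero e
times-two block     = cube

times : ∀ {n} → Even n → ∀ s → Tiling lengths (2 + n ∷ lengths s)
times even-zero   s         = times-two s
times (even-ss e) point     = whole (chain (even-ss e)) (id-iso _)
times (even-ss e) (chain f) = grid (even-ss e) f
times (even-ss e) block     =
  -- One side of the block is set aside by the swap. The long side and the other side 2 form a grid
  -- that is peeled entirely into chains, and multiplying those by 2 is again a matter of grids.
  bindᵗ (whole tt (swap-iso _ _ _))
  λ _ → bindᵗ (consᵗ 2 (grid (even-ss e) even-zero)) (times-two ∘ _)

data AllEven : List ℕ → Set where
  []  : AllEven []
  _∷_ : ∀ {a as} → Even a → AllEven as → AllEven (a ∷ as)

tile-cuboid : ∀ {as} → AllEven as → Tiling lengths as
tile-cuboid []              = whole point (id-iso _)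
tile-cuboid (_∷_ {a} e es) = bindᵗ (consᵗ a (tile-cuboid es)) (extend e)
  where
  extend : ∀ {a} → Even a → ∀ i → Tiling lengths (a ∷ lengths (shape (part (tile-cuboid es)) i))
  extend even-zero   i = whole _ (zero-iso _)
  extend (even-ss e) i = times e _

-- From tilings to symmetric chains.

singly : ℕ → List ℕ
singly a = a ∷ []

record ChainTiling (as : List ℕ) : Set₁ where
  field
    part : Partition singly (cuboid as)
    ends : ∀ i {x y} → x ≢ y → Full as (fun (emb part i) x) (fun (emb part i) y) →
           fun (emb part i) x ≡ bot as × fun (emb part i) y ≡ top as

point-iso : Iso (0 ∷ []) []
point-iso = record
  { to = record { fun = λ _ → tt ; base = 0 ; mono = λ _ → tt ; rank-fun = λ { (zero , _) → refl } ; centred = refl }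
  ; to-taut = record { reflect = λ { {zero , _} {zero , _} _ → inj₁ refl , tt } ; corner = λ _ → refl , refl }
  ; from = λ _ → zero , tt
  ; to-from = λ _ → refl
  ; from-to = λ { (zero , _) → refl } }

split-shape : ∀ s → ChainTiling (lengths s)
split-shape point = record
  { part = part (whole 0 point-iso)
  ; ends = λ { _ {zero , _} {zero , _} x≢y _ → ⊥-elim (x≢y refl) } }
split-shape (chain e) = record
  { part = part (whole _ (id-iso _))
  ; ends = λ { _ x≢y (inj₁ refl , _) → ⊥-elim (x≢y refl)
             ; _ _ (inj₂ (_ , refl , refl) , _) → refl , refl } }
-- No product follows any more, so the block may be peeled and its one-element chain is harmless.
split-shape block = record
  { part = rows
  ; ends = λ i x≢y h → ⊥-elim (x≢y (fun-injective rows i (two-discrete (two-discrete λ _ → refl) h))) }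
  where
  line : ∀ l → Partition singly (cuboid (Peel.layer 0 0 l))
  line lower = part (whole _ (id-iso _))
  line upper = part (whole _ (id-iso _))
  line inner = part (whole _ (zero-iso _))
  rows : Partition singly (cuboid (2 ∷ 2 ∷ []))
  rows = bind split-block line

split-tiling : ∀ {as} → Tiling lengths as → ChainTiling as
split-tiling t = record
  { part = bind (part t) (λ i → ChainTiling.part (split i))
  ; ends = λ (i , k) x≢y h →
      -- First the full pair is moved to the corners of the piece, then tautness moves it to the
      -- corners of the cuboid.
      let (p , q) = ChainTiling.ends (split i) k x≢y (reflect (taut t i) h)
          (r , s) = corner (taut t i)
                      (subst₂ (λ x y → Full _ (fun (emb (part t) i) x) (fun (emb (part t) i) y)) p q h)
      in trans (cong (fun (emb (part t) i)) p) r , trans (cong (fun (emb (part t) i)) q) s }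
  where
  split = λ i → split-shape (shape (part t) i)

abstract
  chain-cuboid : ∀ {as} → AllEven as → ChainTiling as
  chain-cuboid es = split-tiling (tile-cuboid es)

-- Boolean lattices and their partitions into boxes.

subsets : ℕ → Ranked
subsets n = record { Carrier = Subset n ; _≼_ = _⊆_ ; rank = ∣_∣ ; height = n }

∣++∣ : ∀ {m n} (p : Subset m) (q : Subset n) → ∣ p ++ q ∣ ≡ ∣ p ∣ + ∣ q ∣
∣++∣ []            q = refl
∣++∣ (inside ∷ p)  q = cong suc (∣++∣ p q)
∣++∣ (outside ∷ p) q = ∣++∣ p q

++-⊆ : ∀ {m n} (p p′ : Subset m) {q q′ : Subset n} → p ⊆ p′ → q ⊆ q′ → p ++ q ⊆ p′ ++ q′
++-⊆ []       []         h k           = k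
++-⊆ (x ∷ p) (x′ ∷ p′) h k Vec.here with h Vec.here
... | Vec.here = Vec.here
++-⊆ (x ∷ p) (x′ ∷ p′) h k (Vec.there z) = Vec.there (++-⊆ p p′ (drop-∷-⊆ h) k z)

take-++ : ∀ {A : Set} {m n} (xs : Vec A m) (ys : Vec A n) → take m (xs ++ ys) ≡ xs
take-++ {m = m} xs ys = proj₁ (++-injective (take m (xs ++ ys)) xs (take++drop≡id m (xs ++ ys)))

drop-++ : ∀ {A : Set} {m n} (xs : Vec A m) (ys : Vec A n) → drop m (xs ++ ys) ≡ ys
drop-++ {m = m} xs ys = proj₂ (++-injective (take m (xs ++ ys)) xs (take++drop≡id m (xs ++ ys)))

infixr 5 _⊗_

_⊗_ : ∀ {m n} → Partition singly (subsets m) → Partition id (subsets n) → Partition id (subsets (m + n))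
_⊗_ {m} {n} P Q = record
  { I       = I P × I Q
  ; shape   = λ (i , j) → shape P i ∷ shape Q j
  ; emb     = λ (i , j) → record
    { fun      = λ (x , xs) → fun (emb P i) (x , tt) ++ fun (emb Q j) xs
    ; base     = base (emb P i) + base (emb Q j)
    ; mono     = λ (h , hs) → ++-⊆ (fun (emb P i) _) (fun (emb P i) _)
                   (mono (emb P i) (h , tt)) (mono (emb Q j) hs)
    ; rank-fun = λ (x , xs) → trans (∣++∣ (fun (emb P i) (x , tt)) _)
        (trans (cong₂ _+_ (rank-fun (emb P i) (x , tt)) (rank-fun (emb Q j) xs))
               (rearrange (base (emb P i)) (base (emb Q j)) (toℕ x) (rankᶜ xs)))
    ; centred  = trans (rearrange′ (base (emb P i)) (base (emb Q j)) (shape P i) (sumᴸ (shape Q j)))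
        (cong₂ _+_ (centred (emb P i)) (centred (emb Q j))) }
  ; loc     = λ S → let (i , x , _) = loc P (take m S) ; (j , xs) = loc Q (drop m S)
                    in (i , j) , x , xs
  ; fun-loc = λ S → trans (cong₂ _++_ (fun-loc P (take m S)) (fun-loc Q (drop m S))) (take++drop≡id m S)
  ; loc-fun = λ (i , j) (x , xs) →
      let S = fun (emb P i) (x , tt) ; R = fun (emb Q j) xs in
      cong₂ (λ (i , x , _) (j , xs) → (i , j) , x , xs)
        (trans (cong (loc P) (take-++ S R)) (loc-fun P i _))
        (trans (cong (loc Q) (drop-++ S R)) (loc-fun Q j xs)) }
  where
  rearrange : ∀ a b c d → (a + (c + 0)) + (b + d) ≡ (a + b) + (c + d)
  rearrange = solve-∀
  rearrange′ : ∀ a b c d → (a + b) + (a + b) + (c + d) ≡ (a + a + (c + 0)) + (b + b + d)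
  rearrange′ = solve-∀

unit : Partition id (subsets 0)
unit = record
  { I = Unit.⊤ ; shape = λ _ → []
  ; emb = λ _ → record { fun = λ _ → [] ; base = 0 ; mono = λ _ h → h ; rank-fun = λ _ → refl ; centred = refl }
  ; loc = λ _ → tt , tt ; fun-loc = λ { [] → refl } ; loc-fun = λ _ _ → refl }

boxes : ∀ {r} (ns : Vec ℕ r) → (∀ i → Partition singly (subsets (lookup ns i))) →
        Partition id (subsets (sum ns))
boxes []       P = unit
boxes (n ∷ ns) P = P zero ⊗ boxes ns (P ∘ suc)

boxes-even : ∀ {r} (ns : Vec ℕ r) (P : ∀ i → Partition singly (subsets (lookup ns i))) →
             (∀ i j → Even (shape (P i) j)) → ∀ j → AllEven (shape (boxes ns P) j)
boxes-even []       P e _       = []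
boxes-even (n ∷ ns) P e (j , k) = e zero j ∷ boxes-even ns (P ∘ suc) (e ∘ suc) k

-- Points shared by two partitions.

record Compatible {n} {S : Set} {code : S → List ℕ} (P Q : Partition code (subsets n)) : Set where
  field
    -- The form of almost orthogonality that passes to products. Almost orthogonality does not: two
    -- boxes may share `⊥` and `⊤` in some factors while agreeing in a fixed set in the others.
    share : ∀ i j {x y x′ y′} →
            fun (emb P i) x ≡ fun (emb Q j) x′ → fun (emb P i) y ≡ fun (emb Q j) y′ →
            x ≤ᶜ y → x′ ≤ᶜ y′ →
            Full (code (shape P i)) x y × Full (code (shape Q j)) x′ y′
    -- This carries goodness: a common one-element chain would be a piece with both corners shared
    -- and away from `⊥` and `⊤`.
    ends  : ∀ i j →
            fun (emb P i) (bot _) ≡ fun (emb Q j) (bot _) → fun (emb P i) (top _) ≡ fun (emb Q j) (top _) →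
            fun (emb P i) (bot _) ≡ ⊥ × fun (emb P i) (top _) ≡ ⊤

open Compatible

⊥-++ : ∀ m {n} → ⊥ {m} ++ ⊥ {n} ≡ ⊥
⊥-++ zero    = refl
⊥-++ (suc m) = cong (outside ∷_) (⊥-++ m)

⊤-++ : ∀ m {n} → ⊤ {m} ++ ⊤ {n} ≡ ⊤
⊤-++ zero    = refl
⊤-++ (suc m) = cong (inside ∷_) (⊤-++ m)

⊗-compatible : ∀ {m n} {P P′ : Partition singly (subsets m)} {Q Q′ : Partition id (subsets n)} →
               Compatible P P′ → Compatible Q Q′ → Compatible (P ⊗ Q) (P′ ⊗ Q′)
⊗-compatible {m} {P = P} {P′} {Q} {Q′} c d = record
  { share = λ (i , j) (i′ , j′) h k (l , ls) (l′ , ls′) →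
      let (h₁ , h₂) = ++-injective (fun (emb P i) _) (fun (emb P′ i′) _) h
          (k₁ , k₂) = ++-injective (fun (emb P i) _) (fun (emb P′ i′) _) k
          ((f , _) , (f′ , _)) = share c i i′ h₁ k₁ (l , tt) (l′ , tt)
          (g , g′) = share d j j′ h₂ k₂ ls ls′
      in (f , g) , (f′ , g′)
  ; ends = λ (i , j) (i′ , j′) h k →
      let (h₁ , h₂) = ++-injective (fun (emb P i) _) (fun (emb P′ i′) _) h
          (k₁ , k₂) = ++-injective (fun (emb P i) _) (fun (emb P′ i′) _) k
          (e₁ , e₁′) = ends c i i′ h₁ k₁
          (e₂ , e₂′) = ends d j j′ h₂ k₂
      in trans (cong₂ _++_ e₁ e₂) (⊥-++ m) , trans (cong₂ _++_ e₁′ e₂′) (⊤-++ m) }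

boxes-compatible : ∀ {r} (ns : Vec ℕ r) (P Q : ∀ i → Partition singly (subsets (lookup ns i))) →
                   (∀ i → Compatible (P i) (Q i)) → Compatible (boxes ns P) (boxes ns Q)
boxes-compatible []       P Q c = record { share = λ _ _ _ _ _ _ → tt , tt ; ends = λ _ _ _ _ → refl , refl }
boxes-compatible (n ∷ ns) P Q c =
  ⊗-compatible {P = P zero} {Q zero} {boxes ns (P ∘ suc)} {boxes ns (Q ∘ suc)} (c zero)
    (boxes-compatible ns (P ∘ suc) (Q ∘ suc) (c ∘ suc))

refine-boxes : ∀ {n} (P : Partition id (subsets n)) → (∀ i → AllEven (shape P i)) →
               Partition singly (subsets n)
refine-boxes P e = bind P (λ i → ChainTiling.part (chain-cuboid (e i)))

module _ {n} {P : Partition singly (subsets n)} where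

  size-fun : ∀ i x → ∣ fun (emb P i) (x , tt) ∣ ≡ base (emb P i) + toℕ x
  size-fun i x = trans (rank-fun (emb P i) (x , tt)) (cong (base (emb P i) +_) (+-identityʳ _))

  size-≤ : ∀ i {x y} → ∣ fun (emb P i) (x , tt) ∣ ≤ ∣ fun (emb P i) (y , tt) ∣ → toℕ x ≤ toℕ y
  size-≤ i {x} {y} h = +-cancelˡ-≤ (base (emb P i)) _ _ (subst₂ _≤_ (size-fun i x) (size-fun i y) h)

-- By `share` the common pair is full in both boxes, so each chain tiling places it at the corners
-- of its box. The boxes then share both corners, and `ends` identifies these with `⊥` and `⊤`.
refine-shared : ∀ {n} (P Q : Partition id (subsets n)) e f → Compatible P Q →
  let R = refine-boxes P e ; S = refine-boxes Q f in
  ∀ i j {x y x′ y′} →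
  fun (emb R i) x ≡ fun (emb S j) x′ → fun (emb R i) y ≡ fun (emb S j) y′ →
  x ≢ y → x ≤ᶜ y →
  fun (emb R i) x ≡ ⊥ × fun (emb R i) y ≡ ⊤
refine-shared P Q e f c (i , k) (j , l) {x} {y} {x′} {y′} h h′ x≢y x≤y =
  trans (cong (fun (emb P i)) (proj₁ ep)) (proj₁ both) , trans (cong (fun (emb P i)) (proj₂ ep)) (proj₂ both)
  where
  R  = refine-boxes P e
  S  = refine-boxes Q f
  A  = ChainTiling.part (chain-cuboid (e i))
  B  = ChainTiling.part (chain-cuboid (f j))
  x′≢y′ : x′ ≢ y′
  x′≢y′ refl = x≢y (fun-injective R (i , k) (trans h (sym h′)))
  -- The order in the second chain comes from the sets themselves: inclusion orders their sizes, and
  -- size determines the position along a chain.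
  x′≤y′ : x′ ≤ᶜ y′
  x′≤y′ = size-≤ {P = S} (j , l) (subst₂ _≤_ (cong ∣_∣ h) (cong ∣_∣ h′)
            (p⊆q⇒∣p∣≤∣q∣ (mono (emb R (i , k)) x≤y))) , tt
  full = share c i j h h′ (mono (emb A k) x≤y) (mono (emb B l) x′≤y′)
  ep = ChainTiling.ends (chain-cuboid (e i)) k x≢y (proj₁ full)
  eq = ChainTiling.ends (chain-cuboid (f j)) l x′≢y′ (proj₂ full)
  both = ends c i j
    (trans (sym (cong (fun (emb P i)) (proj₁ ep))) (trans h (cong (fun (emb Q j)) (proj₁ eq))))
    (trans (sym (cong (fun (emb P i)) (proj₂ ep))) (trans h′ (cong (fun (emb Q j)) (proj₂ eq))))

-- Short lists without repetition.

all-equal⇒length≤1 : ∀ {A : Set} {xs : List A} → Unique xs →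
                     (∀ {x y} → x ∈ xs → y ∈ xs → x ≡ y) → length xs ≤ 1
all-equal⇒length≤1 {xs = []}         _               h = z≤n
all-equal⇒length≤1 {xs = x ∷ []}     _               h = s≤s z≤n
all-equal⇒length≤1 {xs = x ∷ y ∷ xs} ((x≢y ∷ _) ∷ _) h = ⊥-elim (x≢y (h (here refl) (there (here refl))))

length≤1⇒all-equal : ∀ {A : Set} {xs : List A} → length xs ≤ 1 → ∀ {x y} → x ∈ xs → y ∈ xs → x ≡ y
length≤1⇒all-equal {xs = _ ∷ []}    _        (here refl) (here refl) = refl
length≤1⇒all-equal {xs = _ ∷ _ ∷ _} (s≤s ())

length≡2⇒pair : ∀ {A : Set} {xs : List A} → length xs ≡ 2 → ∀ {a b} → a ∈ xs → b ∈ xs → a ≢ b →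
                ∀ {x} → x ∈ xs → x ≡ a ⊎ x ≡ b
length≡2⇒pair {xs = _ ∷ _ ∷ []} _ (here refl)         (here refl)         a≢b _ = ⊥-elim (a≢b refl)
length≡2⇒pair {xs = _ ∷ _ ∷ []} _ (there (here refl)) (there (here refl)) a≢b _ = ⊥-elim (a≢b refl)
length≡2⇒pair {xs = _ ∷ _ ∷ []} _ (here refl)         (there (here refl)) _ (here x)         = inj₁ x
length≡2⇒pair {xs = _ ∷ _ ∷ []} _ (here refl)         (there (here refl)) _ (there (here x)) = inj₂ x
length≡2⇒pair {xs = _ ∷ _ ∷ []} _ (there (here refl)) (here refl)         _ (here x)         = inj₂ x
length≡2⇒pair {xs = _ ∷ _ ∷ []} _ (there (here refl)) (here refl)         _ (there (here x)) = inj₁ x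

pair⇒length≡2 : ∀ {A : Set} {xs : List A} → Unique xs → ∀ {a b} → a ∈ xs → b ∈ xs → a ≢ b →
                (∀ {x} → x ∈ xs → x ≡ a ⊎ x ≡ b) → length xs ≡ 2
pair⇒length≡2 {xs = []}     _        ()
pair⇒length≡2 {xs = x ∷ []} _        (here refl) (here refl) a≢b _ = ⊥-elim (a≢b refl)
pair⇒length≡2 {xs = x ∷ y ∷ []} _ _ _ _ _ = refl
pair⇒length≡2 {xs = x ∷ y ∷ z ∷ xs} ((x≢y ∷ x≢z ∷ _) ∷ (y≢z ∷ _) ∷ _) _ _ _ h
  with h (here refl) | h (there (here refl)) | h (there (there (here refl)))
... | inj₁ refl | inj₁ refl | _         = ⊥-elim (x≢y refl)
... | inj₁ refl | inj₂ refl | inj₁ refl = ⊥-elim (x≢z refl)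
... | inj₁ refl | inj₂ refl | inj₂ refl = ⊥-elim (y≢z refl)
... | inj₂ refl | inj₂ refl | _         = ⊥-elim (x≢y refl)
... | inj₂ refl | inj₁ refl | inj₂ refl = ⊥-elim (x≢z refl)
... | inj₂ refl | inj₁ refl | inj₁ refl = ⊥-elim (y≢z refl)

unique-singleton : ∀ {A : Set} {xs : List A} {x} → Unique xs → x ∈ xs → (∀ {y} → y ∈ xs → y ≡ x) →
                   xs ≡ [ x ]
unique-singleton {xs = y ∷ []}    _               _ h = cong [_] (h (here refl))
unique-singleton {xs = y ∷ z ∷ _} ((y≢z ∷ _) ∷ _) _ h =
  ⊥-elim (y≢z (trans (h (here refl)) (sym (h (there (here refl))))))

lookup-injective : ∀ {A : Set} {xs : List A} → Unique xs → ∀ i j →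
                   List.lookup xs i ≡ List.lookup xs j → i ≡ j
lookup-injective (_ ∷ _) zero    zero    _ = refl
lookup-injective (u ∷ _) zero    (suc j) h = ⊥-elim (All.lookup u (∈-lookup j) h)
lookup-injective (u ∷ _) (suc i) zero    h = ⊥-elim (All.lookup u (∈-lookup i) (sym h))
lookup-injective (_ ∷ u) (suc i) (suc j) h = cong suc (lookup-injective u i j h)

-- Injectivity is relative to `P` because the map to be used, from a set to its chain, is injective
-- only on the starting sets of chains.
unique-map : ∀ {A B : Set} (P : A → Set) (f : A → B) → (∀ {x y} → P x → P y → f x ≡ f y → x ≡ y) →
             ∀ {xs} → All P xs → Unique xs → Unique (List.map f xs)
unique-map P f inj []         []         = []
unique-map P f inj (px ∷ pxs) (ux ∷ uxs) = fresh pxs ux ∷ unique-map P f inj pxs uxs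
  where
  fresh : ∀ {ys} → All P ys → All (_ ≢_) ys → All (f _ ≢_) (List.map f ys)
  fresh []         []         = []
  fresh (py ∷ pys) (uy ∷ uys) = (λ e → uy (inj px py e)) ∷ fresh pys uys

-- From partitions to lists of symmetric chains.

allSubsets : ∀ n → List (Subset n)
allSubsets zero    = [ [] ]
allSubsets (suc n) = List.map (inside ∷_) (allSubsets n) List.++ List.map (outside ∷_) (allSubsets n)

∈-allSubsets : ∀ {n} (S : Subset n) → S ∈ allSubsets n
∈-allSubsets []            = here refl
∈-allSubsets (inside ∷ S)  = ∈-++⁺ˡ (∈-map⁺ _ (∈-allSubsets S))
∈-allSubsets (outside ∷ S) = ∈-++⁺ʳ _ (∈-map⁺ _ (∈-allSubsets S))

allSubsets-unique : ∀ n → Unique (allSubsets n)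
allSubsets-unique zero    = [] ∷ []
allSubsets-unique (suc n) =
  Unique.++⁺ (Unique.map⁺ ∷-injectiveʳ (allSubsets-unique n)) (Unique.map⁺ ∷-injectiveʳ (allSubsets-unique n))
    λ (h , k) → disjoint (∈-map⁻ _ h) (∈-map⁻ _ k)
  where
  disjoint : ∀ {S} → (∃ λ R → R ∈ allSubsets n × S ≡ inside ∷ R) →
             (∃ λ R → R ∈ allSubsets n × S ≡ outside ∷ R) → Empty.⊥
  disjoint (_ , _ , refl) (_ , _ , ())

centred-∸ : ∀ b a {n} → b + b + (a + 0) ≡ n → n ∸ b ≡ b + a
centred-∸ b a refl = trans
  (cong (_∸ b) (trans (+-assoc b b (a + 0)) (cong (λ a → b + (b + a)) (+-identityʳ a))))
  (m+n∸m≡n b (b + a))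

module Decomposition {n} (P : Partition singly (subsets n)) where

  at : ∀ i → Fin (suc (shape P i)) → Subset n
  at i p = fun (emb P i) (p , tt)

  at-injective : ∀ i {p q} → at i p ≡ at i q → p ≡ q
  at-injective i h = cong proj₁ (fun-injective P i h)

  which : Subset n → I P
  which = proj₁ ∘ loc P

  chainOf : I P → Chain n
  chainOf i = tabulate (at i)

  at-∈ : ∀ i p → at i p ∈ chainOf i
  at-∈ i = ∈-tabulate⁺ {f = at i}

  ∈-at : ∀ {i S} → S ∈ chainOf i → ∃ λ p → S ≡ at i p
  ∈-at = ∈-tabulate⁻

  ∈-which : ∀ {i S} → S ∈ chainOf i → which S ≡ i
  ∈-which {i} S∈ with ∈-at S∈
  ... | p , refl = cong proj₁ (loc-fun P i (p , tt))

  which-∈ : ∀ S → S ∈ chainOf (which S)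
  which-∈ S = subst (_∈ chainOf (which S)) (fun-loc P S) (at-∈ _ _)

  start : I P → Subset n
  start i = at i zero

  -- `I P` comes without an enumeration. Chains are therefore listed by their starting sets, one for
  -- each chain, found among all subsets.
  decomposition : List (Chain n)
  decomposition = List.map (chainOf ∘ which) (filter (λ S → start (which S) ≟S S) (allSubsets n))

  ∈-decomposition : ∀ i → chainOf i ∈ decomposition
  ∈-decomposition i = subst (λ j → chainOf j ∈ decomposition) (∈-which (at-∈ i zero))
    (∈-map⁺ (chainOf ∘ which) (∈-filter⁺ (λ S → start (which S) ≟S S) (∈-allSubsets (start i))
      (cong start (∈-which (at-∈ i zero)))))

  decomposition-∈ : ∀ {C} → C ∈ decomposition → ∃ λ i → C ≡ chainOf i
  decomposition-∈ C∈ = let (S , _ , eq) = ∈-map⁻ (chainOf ∘ which) C∈ in which S , eq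

  chainOf-injective : ∀ {i j} → chainOf i ≡ chainOf j → i ≡ j
  chainOf-injective {i} h = trans (sym (∈-which (at-∈ i zero))) (∈-which (subst (at i zero ∈_) h (at-∈ i zero)))

  decomposition-unique : Unique decomposition
  decomposition-unique = unique-map (λ S → start (which S) ≡ S) (chainOf ∘ which)
    (λ h k e → trans (sym h) (trans (cong start (chainOf-injective e)) k))
    (all-filter (λ S → start (which S) ≟S S) (allSubsets n))
    (Unique.filter⁺ _ (allSubsets-unique n))

  chainOf-unique : ∀ i → Unique (chainOf i)
  chainOf-unique i = Unique.tabulate⁺ (at-injective i)

  chainOf-symmetric : ∀ i → IsSymmetricChain n (chainOf i)
  chainOf-symmetric i = (chainOf-unique i , comparable) , b , b≤n∸b , in-range , hits , level
    where
    b = base (emb P i)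
    n∸b : n ∸ b ≡ b + shape P i
    n∸b = centred-∸ b (shape P i) (centred (emb P i))
    b≤n∸b : b ≤ n ∸ b
    b≤n∸b = subst (b ≤_) (sym n∸b) (m≤m+n b _)
    size : ∀ p → ∣ at i p ∣ ≡ b + toℕ p
    size = size-fun {P = P} i
    comparable : ∀ {S R} → S ∈ chainOf i → R ∈ chainOf i → S ⊆ R ⊎ R ⊆ S
    comparable S∈ R∈ with ∈-at S∈ | ∈-at R∈
    ... | p , refl | q , refl with ≤-total (toℕ p) (toℕ q)
    ... | inj₁ h = inj₁ (mono (emb P i) (h , tt))
    ... | inj₂ h = inj₂ (mono (emb P i) (h , tt))
    in-range : ∀ {S} → S ∈ chainOf i → b ≤ ∣ S ∣ × ∣ S ∣ ≤ n ∸ b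
    in-range S∈ with ∈-at S∈
    ... | p , refl = subst (b ≤_) (sym (size p)) (m≤m+n b _)
                   , subst₂ _≤_ (sym (size p)) (sym n∸b) (+-monoʳ-≤ b (≤-pred (toℕ<n p)))
    hits : ∀ s → b ≤ s → s ≤ n ∸ b → Σ (Subset n) λ S → S ∈ chainOf i × ∣ S ∣ ≡ s
    hits s b≤s s≤ = at i p , at-∈ i p , trans (size p) (trans (cong (b +_) (toℕ-fromℕ< _)) (m+[n∸m]≡n b≤s))
      where
      p = fromℕ< (s≤s (subst (s ∸ b ≤_) (m+n∸m≡n b (shape P i)) (∸-monoˡ-≤ b (subst (s ≤_) n∸b s≤))))
    level : ∀ {S R} → S ∈ chainOf i → R ∈ chainOf i → ∣ S ∣ ≡ ∣ R ∣ → S ≡ R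
    level S∈ R∈ e with ∈-at S∈ | ∈-at R∈
    ... | p , refl | q , refl =
      cong (at i) (toℕ-injective (+-cancelˡ-≡ b _ _ (trans (sym (size p)) (trans e (size q)))))

  decomposition-isSCD : IsSCD n decomposition
  decomposition-isSCD = symmetric , covers
    where
    symmetric : ∀ {C} → C ∈ decomposition → IsSymmetricChain n C
    symmetric C∈ with decomposition-∈ C∈
    ... | i , refl = chainOf-symmetric i
    covers : ∀ S → Σ (Fin (length decomposition)) λ i →
             S ∈ List.lookup decomposition i × (∀ j → S ∈ List.lookup decomposition j → j ≡ i)
    covers S = index C∈ , subst (S ∈_) (lookup-index C∈) (which-∈ S) , unique
      where
      C∈ = ∈-decomposition (which S)
      unique : ∀ j → S ∈ List.lookup decomposition j → j ≡ index C∈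
      unique j S∈ with decomposition-∈ (∈-lookup {xs = decomposition} j)
      ... | i , eq = lookup-injective decomposition-unique j (index C∈)
        (trans eq (trans (cong chainOf (sym (∈-which (subst (S ∈_) eq S∈)))) (lookup-index C∈)))

-- Almost orthogonality in terms of pairs of common sets.

⊥≢⊤ : ∀ {n} → 1 ≤ n → ⊥ {n} ≢ ⊤
⊥≢⊤ {suc n} _ ()

module _ {n} (A C : Chain n) where
  open DecMembership (_≟S_ {n}) using (_∈?_)

  common : Chain n
  common = filter (λ x → x ∈? C) A

  common⁺ : ∀ {x} → x ∈ A → x ∈ C → x ∈ common
  common⁺ = ∈-filter⁺ (λ x → x ∈? C)

  common⁻ : ∀ {x} → x ∈ common → x ∈ A × x ∈ C
  common⁻ = ∈-filter⁻ (λ x → x ∈? C)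

  almost-orthogonal⁺ : 1 ≤ n → Unique A →
    (∀ {x y} → x ∈ common → y ∈ common → x ≢ y → (x ≡ ⊥ × y ≡ ⊤) ⊎ (x ≡ ⊤ × y ≡ ⊥)) →
    (BothFull A C → interSize A C ≡ 2) × (¬ BothFull A C → interSize A C ≤ 1)
  almost-orthogonal⁺ 1≤n u h = both , few
    where
    u′ : Unique common
    u′ = Unique.filter⁺ (λ x → x ∈? C) u
    both : BothFull A C → interSize A C ≡ 2
    both (b , t , b′ , t′) = pair⇒length≡2 u′ (common⁺ b b′) (common⁺ t t′) (⊥≢⊤ 1≤n) extreme
      where
      extreme : ∀ {x} → x ∈ common → x ≡ ⊥ ⊎ x ≡ ⊤
      extreme {x} x∈ with x ≟S ⊥
      ... | yes e = inj₁ e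
      -- A common set other than `⊥` is paired with `⊥` itself, which is common here.
      ... | no ¬e with h x∈ (common⁺ b b′) ¬e
      ... | inj₁ (e , _) = inj₁ e
      ... | inj₂ (e , _) = inj₂ e
    few : ¬ BothFull A C → interSize A C ≤ 1
    few ¬full = all-equal⇒length≤1 u′ equal
      where
      full : ∀ {x y} → x ∈ common → y ∈ common → x ≡ ⊥ → y ≡ ⊤ → BothFull A C
      full x∈ y∈ refl refl = let (a , b) = common⁻ x∈ ; (c , d) = common⁻ y∈ in a , c , b , d
      equal : ∀ {x y} → x ∈ common → y ∈ common → x ≡ y
      equal {x} {y} x∈ y∈ with x ≟S y
      ... | yes e = e
      ... | no ¬e with h x∈ y∈ ¬e
      ... | inj₁ (e , e′) = ⊥-elim (¬full (full x∈ y∈ e e′))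
      ... | inj₂ (e , e′) = ⊥-elim (¬full (full y∈ x∈ e′ e))

  -- `BothFull` is decidable. If it holds, `⊥` and `⊤` already exhaust the two common sets; if not,
  -- two distinct common sets exceed the bound 1.
  almost-orthogonal⁻ : 1 ≤ n →
    (BothFull A C → interSize A C ≡ 2) × (¬ BothFull A C → interSize A C ≤ 1) →
    ∀ {x y} → x ∈ A → x ∈ C → y ∈ A → y ∈ C → x ≢ y → x ≡ ⊥ ⊎ x ≡ ⊤
  almost-orthogonal⁻ 1≤n (both , few) x∈A x∈C y∈A y∈C x≢y
    with (⊥ ∈? A) ×-dec (⊤ ∈? A) ×-dec (⊥ ∈? C) ×-dec (⊤ ∈? C)
  ... | yes full@(b , t , b′ , t′) =
    length≡2⇒pair (both full) (common⁺ b b′) (common⁺ t t′) (⊥≢⊤ 1≤n) (common⁺ x∈A x∈C)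
  ... | no ¬full = ⊥-elim (x≢y (length≤1⇒all-equal (few ¬full) (common⁺ x∈A x∈C) (common⁺ y∈A y∈C)))

open Decomposition

decomposition-almost-orthogonal : ∀ {n} → 1 ≤ n → (P Q : Partition singly (subsets n)) →
  (∀ i j {x y x′ y′} →
   fun (emb P i) x ≡ fun (emb Q j) x′ → fun (emb P i) y ≡ fun (emb Q j) y′ →
   x ≢ y → x ≤ᶜ y → fun (emb P i) x ≡ ⊥ × fun (emb P i) y ≡ ⊤) →
  AlmostOrthogonal n (decomposition P) (decomposition Q)
decomposition-almost-orthogonal 1≤n P Q shared A∈ C∈
  with decomposition-∈ P A∈ | decomposition-∈ Q C∈
... | i , refl | j , refl = almost-orthogonal⁺ (chainOf P i) (chainOf Q j) 1≤n (chainOf-unique P i) extremes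
  where
  extremes : ∀ {S R} → S ∈ common (chainOf P i) (chainOf Q j) → R ∈ common (chainOf P i) (chainOf Q j) →
             S ≢ R → (S ≡ ⊥ × R ≡ ⊤) ⊎ (S ≡ ⊤ × R ≡ ⊥)
  extremes S∈ R∈ S≢R
    with common⁻ (chainOf P i) (chainOf Q j) S∈ | common⁻ (chainOf P i) (chainOf Q j) R∈
  ... | S∈P , S∈Q | R∈P , R∈Q with ∈-at P S∈P | ∈-at Q S∈Q | ∈-at P R∈P | ∈-at Q R∈Q
  ... | p , refl | p′ , h | q , refl | q′ , k with ≤-total (toℕ p) (toℕ q)
  ... | inj₁ l = inj₁ (shared i j h k (λ { refl → S≢R refl }) (l , tt))
  ... | inj₂ l = inj₂ (let (e , e′) = shared i j k h (λ { refl → S≢R refl }) (l , tt) in e′ , e)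

-- From lists of symmetric chains to partitions.

module FromSCD {n} {F : List (Chain n)} (scd : IsSCD n F) where

  member : Fin (length F) → Chain n
  member = List.lookup F

  symmetric : ∀ i → IsSymmetricChain n (member i)
  symmetric i = proj₁ scd (∈-lookup i)

  abstract
    low : Fin (length F) → ℕ
    low i = proj₁ (proj₂ (symmetric i))

    low≤ : ∀ i → low i ≤ n ∸ low i
    low≤ i = proj₁ (proj₂ (proj₂ (symmetric i)))

    in-range : ∀ i {S} → S ∈ member i → low i ≤ ∣ S ∣ × ∣ S ∣ ≤ n ∸ low i
    in-range i = proj₁ (proj₂ (proj₂ (proj₂ (symmetric i))))

    hits : ∀ i s → low i ≤ s → s ≤ n ∸ low i → Σ (Subset n) λ S → S ∈ member i × ∣ S ∣ ≡ s
    hits i = proj₁ (proj₂ (proj₂ (proj₂ (proj₂ (symmetric i)))))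

    level : ∀ i {S R} → S ∈ member i → R ∈ member i → ∣ S ∣ ≡ ∣ R ∣ → S ≡ R
    level i = proj₂ (proj₂ (proj₂ (proj₂ (proj₂ (symmetric i)))))

  len : Fin (length F) → ℕ
  len i = n ∸ low i ∸ low i

  -- The list order of a chain is arbitrary, so its sets are indexed by size above `low i`; `level`
  -- makes the set found by `hits` unique.
  nth : ∀ i (p : Fin (suc (len i))) → Σ (Subset n) λ S → S ∈ member i × ∣ S ∣ ≡ low i + toℕ p
  nth i p = hits i (low i + toℕ p) (m≤m+n _ _)
    (subst (low i + toℕ p ≤_) (m+[n∸m]≡n (low≤ i)) (+-monoʳ-≤ (low i) (≤-pred (toℕ<n p))))

  elt : ∀ i → Fin (suc (len i)) → Subset n
  elt i p = proj₁ (nth i p)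

  elt-∈ : ∀ i p → elt i p ∈ member i
  elt-∈ i p = proj₁ (proj₂ (nth i p))

  elt-size : ∀ i p → ∣ elt i p ∣ ≡ low i + toℕ p
  elt-size i p = proj₂ (proj₂ (nth i p))

  position : ∀ i {S} → S ∈ member i → Fin (suc (len i))
  position i {S} S∈ = fromℕ< (s≤s (∸-monoˡ-≤ (low i) (proj₂ (in-range i S∈))))

  toℕ-position : ∀ i {S} (S∈ : S ∈ member i) → toℕ (position i S∈) ≡ ∣ S ∣ ∸ low i
  toℕ-position i S∈ = toℕ-fromℕ< _

  elt-position : ∀ i {S} (S∈ : S ∈ member i) → elt i (position i S∈) ≡ S
  elt-position i {S} S∈ = level i (elt-∈ i _) S∈
    (trans (elt-size i _) (trans (cong (low i +_) (toℕ-position i S∈)) (m+[n∸m]≡n (proj₁ (in-range i S∈)))))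

  -- The membership proof is arbitrary because `locate` uses the one supplied by the covering.
  position-elt : ∀ i p (S∈ : elt i p ∈ member i) → position i S∈ ≡ p
  position-elt i p S∈ = toℕ-injective (trans (toℕ-position i S∈)
    (trans (cong (_∸ low i) (elt-size i p)) (m+n∸m≡n (low i) (toℕ p))))

  locate : Subset n → Σ (Fin (length F)) λ i → Point (singly (len i))
  locate S = let (i , S∈ , _) = proj₂ scd S in i , position i S∈ , tt

  locate-unique : ∀ i p → locate (elt i p) ≡ (i , p , tt)
  locate-unique i p with proj₂ scd (elt i p)
  ... | j , S∈ , unique with unique i (elt-∈ i p)
  ... | refl = cong (λ p → i , p , tt) (position-elt i p S∈)

  elt-mono : ∀ i {p q} → toℕ p ≤ toℕ q → elt i p ⊆ elt i q
  elt-mono i {p} {q} h with proj₂ (proj₁ (symmetric i)) (elt-∈ i p) (elt-∈ i q)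
  ... | inj₁ k = k
  -- With the inclusion reversed the two sizes agree, and `level` makes the sets equal.
  ... | inj₂ k rewrite level i (elt-∈ i p) (elt-∈ i q)
    (≤-antisym (subst₂ _≤_ (sym (elt-size i p)) (sym (elt-size i q)) (+-monoʳ-≤ (low i) h)) (p⊆q⇒∣p∣≤∣q∣ k))
    = id

  len-centred : ∀ i → low i + low i + (len i + 0) ≡ n
  len-centred i = begin
    low i + low i + (len i + 0)  ≡⟨ cong (low i + low i +_) (+-identityʳ _) ⟩
    low i + low i + len i        ≡⟨ +-assoc (low i) _ _ ⟩
    low i + (low i + len i)      ≡⟨ cong (low i +_) (m+[n∸m]≡n (low≤ i)) ⟩
    low i + (n ∸ low i)          ≡⟨ m+[n∸m]≡n (≤-trans (low≤ i) (m∸n≤m n (low i))) ⟩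
    n                            ∎
    where open ≡-Reasoning

  partition : Partition singly (subsets n)
  partition = record
    { I       = Fin (length F)
    ; shape   = len
    ; emb     = λ i → record
      { fun      = λ (p , _) → elt i p
      ; base     = low i
      ; mono     = λ { {p , _} {q , _} (h , _) → elt-mono i {p} {q} h }
      ; rank-fun = λ (p , _) → trans (elt-size i p) (cong (low i +_) (sym (+-identityʳ _)))
      ; centred  = len-centred i }
    ; loc     = locate
    ; fun-loc = λ S → elt-position _ (proj₁ (proj₂ (proj₂ scd S)))
    ; loc-fun = λ i (p , _) → locate-unique i p }

  len-even : Even n → ∀ i → Even (len i)
  len-even e i = cancel (low i)
    (subst Even (sym (trans (cong (low i + low i +_) (sym (+-identityʳ _))) (len-centred i))) e)
    where
    cancel : ∀ b {a} → Even (b + b + a) → Even a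
    cancel zero    e = e
    cancel (suc b) e rewrite +-suc b b with e
    ... | even-ss e = cancel b e

  -- Goodness speaks of literal lists `[ x ]`, so a chain with coinciding ends must be recognised as
  -- one. Equal ends have equal sizes, which forces `len i` to be 0.
  single : ∀ i → elt i zero ≡ elt i (fromℕ _) → member i ≡ [ elt i zero ]
  single i h = unique-singleton (proj₁ (proj₁ (symmetric i))) (elt-∈ i zero)
    λ {S} S∈ → trans (sym (elt-position i S∈)) (cong (elt i) (toℕ-injective (n≤0⇒n≡0
      (subst (toℕ (position i S∈) ≤_) len≡0 (≤-pred (toℕ<n _))))))
    where
    len≡0 : len i ≡ 0
    len≡0 = trans (sym (toℕ-fromℕ _)) (sym (+-cancelˡ-≡ (low i) _ _
      (trans (sym (elt-size i zero)) (trans (cong ∣_∣ h) (elt-size i _)))))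

  -- Containing `⊥` forces `low i` to be 0. The resulting `len i ≡ n` later turns `4 ≤ n` into the
  -- bound required by `Full₁`.
  extreme-positions : ∀ i {p q} → elt i p ≡ ⊥ → elt i q ≡ ⊤ → p ≡ zero × q ≡ fromℕ _ × len i ≡ n
  extreme-positions i {p} {q} h k =
    toℕ-injective (m+n≡0⇒n≡0 (low i) sum≡0) ,
    toℕ-injective (trans q≡n (trans (sym len≡n) (sym (toℕ-fromℕ _)))) , len≡n
    where
    sum≡0 : low i + toℕ p ≡ 0
    sum≡0 = trans (sym (elt-size i p)) (trans (cong ∣_∣ h) (∣⊥∣≡0 n))
    low≡0 : low i ≡ 0
    low≡0 = m+n≡0⇒m≡0 (low i) sum≡0
    len≡n : len i ≡ n
    len≡n = cong (λ b → n ∸ b ∸ b) low≡0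
    q≡n : toℕ q ≡ n
    q≡n = trans (cong (_+ toℕ q) (sym low≡0)) (trans (sym (elt-size i q)) (trans (cong ∣_∣ k) (∣⊤∣≡n n)))

-- Compatibility from almost orthogonality and goodness.

module _ {n} (4≤n : 4 ≤ n) {F G : List (Chain n)} (f : IsSCD n F) (g : IsSCD n G)
         (ao : AlmostOrthogonal n F G) (distinct : ∀ x → [ x ] ∈ F → ¬ [ x ] ∈ G) where
  private
    module P = FromSCD f
    module Q = FromSCD g

  scd-compatible : Compatible P.partition Q.partition
  scd-compatible = record { share = share′ ; ends = ends′ }
    where
    1≤n : 1 ≤ n
    1≤n = ≤-trans (s≤s z≤n) 4≤n

    extreme : ∀ i j {p q p′ q′} → P.elt i p ≡ Q.elt j p′ → P.elt i q ≡ Q.elt j q′ →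
              P.elt i p ≢ P.elt i q → P.elt i p ≡ ⊥ ⊎ P.elt i p ≡ ⊤
    extreme i j {p} {q} {p′} {q′} h k =
      almost-orthogonal⁻ (P.member i) (Q.member j) 1≤n (ao (∈-lookup i) (∈-lookup j))
        (P.elt-∈ i p) (subst (_∈ Q.member j) (sym h) (Q.elt-∈ j p′))
        (P.elt-∈ i q) (subst (_∈ Q.member j) (sym k) (Q.elt-∈ j q′))

    ordered : ∀ i j {p q p′ q′} → P.elt i p ≡ Q.elt j p′ → P.elt i q ≡ Q.elt j q′ →
              P.elt i p ≢ P.elt i q → toℕ p ≤ toℕ q → P.elt i p ≡ ⊥ × P.elt i q ≡ ⊤
    ordered i j {p} {q} h k ne l with extreme i j h k ne | extreme i j k h (ne ∘ sym)
    ... | inj₁ a | inj₁ b = ⊥-elim (ne (trans a (sym b)))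
    ... | inj₁ a | inj₂ b = a , b
    ... | inj₂ a | inj₂ b = ⊥-elim (ne (trans a (sym b)))
    -- Here `⊤` would precede `⊥` in the chain, so `n ≤ 0`.
    ... | inj₂ a | inj₁ b = ⊥-elim (<⇒≱ 1≤n (subst₂ _≤_
      (trans (cong ∣_∣ a) (∣⊤∣≡n n)) (trans (cong ∣_∣ b) (∣⊥∣≡0 n)) (p⊆q⇒∣p∣≤∣q∣ (P.elt-mono i {p} {q} l))))

    share′ : ∀ i j {x y x′ y′} → fun (emb P.partition i) x ≡ fun (emb Q.partition j) x′ →
             fun (emb P.partition i) y ≡ fun (emb Q.partition j) y′ → x ≤ᶜ y → x′ ≤ᶜ y′ →
             Full (singly (P.len i)) x y × Full (singly (Q.len j)) x′ y′
    share′ i j {p , _} {q , _} {p′ , _} {q′ , _} h k (l , _) _ with P.elt i p ≟S P.elt i q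
    ... | yes e = (inj₁ (cong proj₁ (fun-injective P.partition i e)) , tt)
                , (inj₁ (cong proj₁ (fun-injective Q.partition j (trans (sym h) (trans e k)))) , tt)
    ... | no ne with ordered i j h k ne l
    ... | a , b with P.extreme-positions i a b | Q.extreme-positions j (trans (sym h) a) (trans (sym k) b)
    ... | c , d , e | c′ , d′ , e′ = (inj₂ (subst (4 ≤_) (sym e) 4≤n , c , d) , tt)
                                    , (inj₂ (subst (4 ≤_) (sym e′) 4≤n , c′ , d′) , tt)

    ends′ : ∀ i j → P.elt i zero ≡ Q.elt j zero → P.elt i (fromℕ _) ≡ Q.elt j (fromℕ _) →
            P.elt i zero ≡ ⊥ × P.elt i (fromℕ _) ≡ ⊤
    ends′ i j h k with P.elt i zero ≟S P.elt i (fromℕ _)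
    ... | no ne = ordered i j h k ne z≤n
    -- Coinciding ends make both chains the same one-element list, against goodness.
    ... | yes e = ⊥-elim (distinct (P.elt i zero)
      (subst (_∈ F) (P.single i e) (∈-lookup i))
      (subst (_∈ G) (trans (Q.single j (trans (sym h) (trans e k))) (cong [_] (sym h))) (∈-lookup j)))

-- At most two pairwise almost orthogonal decompositions for n = 2.

atom : ∀ {S : Subset 2} → ∣ S ∣ ≡ 1 → S ≡ inside ∷ outside ∷ [] ⊎ S ≡ outside ∷ inside ∷ []
atom {inside ∷ outside ∷ []}  _ = inj₁ refl
atom {outside ∷ inside ∷ []}  _ = inj₂ refl
atom {inside ∷ inside ∷ []}   ()
atom {outside ∷ outside ∷ []} ()

module _ {F : List (Chain 2)} (f : IsSCD 2 F) where
  private module P = FromSCD f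

  full-chain : Fin (length F)
  full-chain = proj₁ (proj₂ f ⊥)

  ⊥∈full : ⊥ ∈ P.member full-chain
  ⊥∈full = proj₁ (proj₂ (proj₂ f ⊥))

  full-atom : Σ (Subset 2) λ S → S ∈ P.member full-chain × ∣ S ∣ ≡ 1
  full-atom = P.hits full-chain 1
    (subst (_≤ 1) (sym low≡0) z≤n) (subst (λ b → 1 ≤ 2 ∸ b) (sym low≡0) (s≤s z≤n))
    where
    low≡0 : P.low full-chain ≡ 0
    low≡0 = n≤0⇒n≡0 (proj₁ (P.in-range full-chain ⊥∈full))

-- The two chains through `⊥` already share `⊥`, so any further common set would have to be `⊥` or
-- `⊤`, and an atom has size 1.
distinct-atoms : ∀ {F G} (f : IsSCD 2 F) (g : IsSCD 2 G) → AlmostOrthogonal 2 F G →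
                 proj₁ (full-atom f) ≢ proj₁ (full-atom g)
distinct-atoms {F} {G} f g ao e = absurd
  (almost-orthogonal⁻ (FromSCD.member f (full-chain f)) (FromSCD.member g (full-chain g))
    (s≤s z≤n) (ao (∈-lookup (full-chain f)) (∈-lookup (full-chain g)))
    (proj₁ (proj₂ (full-atom f)))
    (subst (_∈ FromSCD.member g (full-chain g)) (sym e) (proj₁ (proj₂ (full-atom g))))
    (⊥∈full f) (⊥∈full g) λ S≡⊥ → 1+n≢0 (trans (sym size) (cong ∣_∣ S≡⊥)))
  where
  size = proj₂ (proj₂ (full-atom f))
  absurd : proj₁ (full-atom f) ≡ ⊥ ⊎ proj₁ (full-atom f) ≡ ⊤ → Empty.⊥
  absurd (inj₁ S≡⊥) with trans (sym size) (cong ∣_∣ S≡⊥)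
  ... | ()
  absurd (inj₂ S≡⊤) with trans (sym size) (cong ∣_∣ S≡⊤)
  ... | ()

-- Pigeonhole: the chains through `⊥` in three decompositions need three different atoms, and there
-- are only two.
not-three-of-two : ∀ {k} → 3 ≤ k → (F : Fin k → List (Chain 2)) → ¬ PairwiseAO 2 k F
not-three-of-two (s≤s (s≤s (s≤s _))) F (scd , ao)
  with atom (proj₂ (proj₂ (full-atom (scd zero))))
     | atom (proj₂ (proj₂ (full-atom (scd (suc zero)))))
     | atom (proj₂ (proj₂ (full-atom (scd (suc (suc zero))))))
... | inj₁ a | inj₁ b | _      = distinct-atoms (scd _) (scd _) (ao _ _ λ ()) (trans a (sym b))
... | inj₂ a | inj₂ b | _      = distinct-atoms (scd _) (scd _) (ao _ _ λ ()) (trans a (sym b))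
... | inj₁ a | inj₂ _ | inj₁ c = distinct-atoms (scd _) (scd _) (ao _ _ λ ()) (trans a (sym c))
... | inj₂ a | inj₁ _ | inj₂ c = distinct-atoms (scd _) (scd _) (ao _ _ λ ()) (trans a (sym c))
... | inj₁ _ | inj₂ b | inj₂ c = distinct-atoms (scd _) (scd _) (ao _ _ λ ()) (trans b (sym c))
... | inj₂ _ | inj₁ b | inj₁ c = distinct-atoms (scd _) (scd _) (ao _ _ λ ()) (trans b (sym c))

-- Containment in cuboids, and assembly of the theorem.

2∣⇒Even : ∀ {n} → 2 ∣ n → Even n
2∣⇒Even (divides q refl) = double q
  where
  double : ∀ q → Even (q * 2)
  double zero    = even-zero
  double (suc q) = even-ss (double q)

even≢2⇒4≤ : ∀ {n} → 2 ≤ n → Even n → n ≢ 2 → 4 ≤ n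
even≢2⇒4≤ _ (even-ss even-zero)        n≢2 = ⊥-elim (n≢2 refl)
even≢2⇒4≤ _ (even-ss (even-ss _)) _   = s≤s (s≤s (s≤s (s≤s z≤n)))

boxes-index : ∀ {r} (ns : Vec ℕ r) {F : ∀ i → List (Chain (lookup ns i))}
              (f : ∀ i → IsSCD (lookup ns i) (F i)) →
              I (boxes ns (λ i → FromSCD.partition (f i))) → ∀ i → Fin (length (F i))
boxes-index (n ∷ ns) f (j , k) zero    = j
boxes-index (n ∷ ns) f (j , k) (suc i) = boxes-index ns (f ∘ suc) k i

boxes-inCuboid : ∀ {r} (ns : Vec ℕ r) {F : ∀ i → List (Chain (lookup ns i))}
                 (f : ∀ i → IsSCD (lookup ns i) (F i)) k x →
                 InCuboid ns (λ i → List.lookup (F i) (boxes-index ns f k i))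
                   (fun (emb (boxes ns (λ i → FromSCD.partition (f i))) k) x)
boxes-inCuboid []       f k       x        = tt
boxes-inCuboid (n ∷ ns) {F} f (j , k) (x , xs) =
  subst (_∈ List.lookup (F zero) j) (sym (take-++ (FromSCD.elt (f zero) j x) rest)) (FromSCD.elt-∈ (f zero) j x) ,
  subst (InCuboid ns _) (sym (drop-++ (FromSCD.elt (f zero) j x) rest)) (boxes-inCuboid ns (f ∘ suc) k xs)
  where
  rest = fun (emb (boxes ns (λ i → FromSCD.partition (f (suc i)))) k) xs

1≤sum : ∀ {r} (ns : Vec ℕ r) → 1 ≤ r → (∀ i → 2 ≤ lookup ns i) → 1 ≤ sum ns
1≤sum (n ∷ ns) _ h = ≤-trans (≤-trans (s≤s z≤n) (h zero)) (m≤m+n n _)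

refine-boxes-contained : ∀ {n} (P : Partition id (subsets n)) e {C} →
                         C ∈ decomposition (refine-boxes P e) →
                         ∃ λ b → ∀ {S} → S ∈ C → ∃ λ x → S ≡ fun (emb P b) x
refine-boxes-contained P e C∈ with decomposition-∈ (refine-boxes P e) C∈
... | (b , _) , refl = b , λ S∈ → let (_ , h) = ∈-at (refine-boxes P e) S∈ in _ , h

theorem8p1 : (k r : ℕ) → 3 ≤ k → 1 ≤ r → (ns : Vec ℕ r) →
    (∀ i → 2 ≤ lookup ns i) → (∀ i → 2 ∣ lookup ns i) →
    (F : (i : Fin r) → Fin k → List (Chain (lookup ns i))) →
    (∀ i → IsGood (lookup ns i) k (F i)) →
    Σ (Fin k → List (Chain (sum ns))) λ H →
    PairwiseAO (sum ns) k H ×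
    (∀ j {C} → C ∈ H j →
    Σ ((i : Fin r) → Chain (lookup ns i)) λ A →
    (∀ i → A i ∈ F i j) × (∀ {x} → x ∈ C → InCuboid ns A x))
theorem8p1 k r 3≤k 1≤r ns 2≤n 2∣n F good =
  decomposition ∘ H , (decomposition-isSCD ∘ H , orthogonal) , contained
  where
  scd : ∀ j i → IsSCD (lookup ns i) (F i j)
  scd j i = proj₁ (proj₁ (proj₂ (good i))) j

  -- The size is a variable here so that the equation can be matched; `lookup ns i` does not unify
  -- with 2.
  ≢2 : ∀ {n} (G : Fin k → List (Chain n)) → PairwiseAO n k G → n ≢ 2
  ≢2 G ao refl = not-three-of-two 3≤k G ao

  P : ∀ j i → Partition singly (subsets (lookup ns i))
  P j i = FromSCD.partition (scd j i)

  P-even : ∀ j k → AllEven (shape (boxes ns (P j)) k)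
  P-even j = boxes-even ns (P j) λ i → FromSCD.len-even (scd j i) (2∣⇒Even (2∣n i))

  H : ∀ j → Partition singly (subsets (sum ns))
  H j = refine-boxes (boxes ns (P j)) (P-even j)

  P-compatible : ∀ j j′ → j ≢ j′ → ∀ i → Compatible (P j i) (P j′ i)
  P-compatible j j′ j≢j′ i = let (_ , ao , distinct) = good i in
    scd-compatible (even≢2⇒4≤ (2≤n i) (2∣⇒Even (2∣n i)) (≢2 (F i) ao)) (scd j i) (scd j′ i)
      (proj₂ ao j j′ j≢j′) (distinct j j′ j≢j′)

  orthogonal : ∀ j j′ → j ≢ j′ → AlmostOrthogonal (sum ns) (decomposition (H j)) (decomposition (H j′))
  orthogonal j j′ j≢j′ = decomposition-almost-orthogonal (1≤sum ns 1≤r 2≤n) (H j) (H j′)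
    (refine-shared (boxes ns (P j)) (boxes ns (P j′)) (P-even j) (P-even j′)
      (boxes-compatible ns (P j) (P j′) (P-compatible j j′ j≢j′)))

  contained : ∀ j {C} → C ∈ decomposition (H j) →
              Σ ((i : Fin r) → Chain (lookup ns i)) λ A →
              (∀ i → A i ∈ F i j) × (∀ {x} → x ∈ C → InCuboid ns A x)
  contained j C∈ =
    let (b , inside-box) = refine-boxes-contained (boxes ns (P j)) (P-even j) C∈ in
    (λ i → List.lookup (F i j) (boxes-index ns (scd j) b i)) , (λ i → ∈-lookup _) ,
    λ x∈ → let (y , h) = inside-box x∈ in
           subst (InCuboid ns _) (sym h) (boxes-inCuboid ns (scd j) b y)
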